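{- Let $\delta$ and $\alpha$ be positive real numbers and let $\Delta$ be a positive integer. Let $G$ be an $n$-vertex graph of minimum degree at least $(\delta+\alpha)n$. Then $G$ contains (as a subgraph) every bipartite graph $H$ on at most $\delta n$ vertices with maximum degree at most $\Delta$ and bandwidth at most $\frac{1}{256\Delta}\alpha^{6\Delta+1}n$.
   Context: The bandwidth of an $m$-vertex graph $H$ is the minimum integer $b$ for which there is a labelling of $V(H)$ by $[m]$ (bijectively) such that $|i-j|\le b$ for every edge $\{i,j\}\in E(H)$.
   Formalization: The positive numbers δ and α are taken rational rather than real; the real case follows by replacing δ with |V(H)|/n and α with (minimum degree of G minus |V(H)|)/n. -}

module Defs where

open import Data.Nat as ℕ using (ℕ; zero; suc; _≤_; ∣_-_∣)
open import Data.Bool using (Bool; true; false; if_then_else_)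
open import Data.Fin using (Fin; toℕ)
open import Data.List using (List; map)
open import Data.Nat.ListAction using (sum)
open import Data.List using () renaming (allFin to allFinL)
open import Data.Product using (Σ; _×_; ∃)
open import Data.Fin.Permutation using (Permutation′; _⟨$⟩ʳ_)
open import Function.Definitions using (Injective)
open import Relation.Binary.PropositionalEquality using (_≡_; _≢_)
open import Data.Integer as ℤ using (ℤ)
open import Data.Rational as ℚ using (ℚ; 1ℚ)

record Graph (n : ℕ) : Set where
  field
    adj   : Fin n → Fin n → Bool
    sym   : ∀ u v → adj u v ≡ adj v u
    irrefl : ∀ v → adj v v ≡ false
open Graph public

degree : ∀ {n} → Graph n → Fin n → ℕ
degree {n} G v = sum (map (λ u → if adj G v u then 1 else 0) (allFinL n))

-- minimum degree at least d  (for n = 0 this holds vacuously)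
MinDegreeAtLeast : ∀ {n} → Graph n → ℚ → Set
MinDegreeAtLeast {n} G d = ∀ v → d ℚ.≤ (ℤ.+ degree G v ℚ./ 1)

MaxDegreeAtMost : ∀ {m} → Graph m → ℕ → Set
MaxDegreeAtMost H Δ = ∀ v → degree H v ≤ Δ

Bipartite : ∀ {m} → Graph m → Set
Bipartite {m} H = Σ (Fin m → Bool) λ c → ∀ u v → adj H u v ≡ true → c u ≢ c v

-- the bandwidth of H is at most b: some bijective labelling of V(H) by
-- Fin m (= [m] shifted by one) stretches every edge by at most b.
-- (bandwidth = minimum such b, so "bandwidth ≤ b" is exactly this.)
BandwidthAtMost : ∀ {m} → Graph m → ℕ → Set
BandwidthAtMost {m} H b = Σ (Permutation′ m) λ σ →
  ∀ u v → adj H u v ≡ true → ∣ toℕ (σ ⟨$⟩ʳ u) - toℕ (σ ⟨$⟩ʳ v) ∣ ≤ b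

SubgraphOf : ∀ {m n} → Graph m → Graph n → Set
SubgraphOf {m} {n} H G = Σ (Fin m → Fin n) λ φ →
  Injective _≡_ _≡_ φ × (∀ u v → adj H u v ≡ true → adj G (φ u) (φ v) ≡ true)

ℕ→ℚ : ℕ → ℚ
ℕ→ℚ k = ℤ.+ k ℚ./ 1

_^ℚ_ : ℚ → ℕ → ℚ
x ^ℚ zero = 1ℚ
x ^ℚ suc k = x ℚ.* (x ^ℚ k)

{-# OPTIONS --safe #-}
module Submission where

-- Let X and Y be the colour classes of H, and move the labels of Y up by the bandwidth b. Every
-- edge then runs from X to Y by between 0 and 2b, so cutting the labels into windows of length 2b
-- gives layers X₀, Y₀, X₁, Y₁, … in which Yᵢ is joined only to Xᵢ₋₁ and Xᵢ. The layers are embedded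
-- in this order. At most δn vertices of G are ever used, so in the set U of unused vertices every
-- vertex of G keeps at least αn neighbours.
--
-- Before Xᵢ is embedded, dependent random choice gives a Δ-tuple tᵢ₊₁ of unused vertices such that
-- few Δ-tuples of N(tᵢ₊₁) ∩ U have fewer than 8b common neighbours in U, while N(tᵢ₊₁) ∩ U and
-- N(tᵢ) ∩ N(tᵢ₊₁) ∩ U are both large; the last two hold together because Jensen's inequality bounds
-- the sum over t of |N(t) ∩ N(tᵢ) ∩ U| · |N(t) ∩ U| from below. Xᵢ is placed in
-- N(tᵢ) ∩ N(tᵢ₊₁) ∩ U greedily, so that the neighbourhoods of vertices of Yᵢ and Yᵢ₊₁ never become
-- bad tuples. Then each vertex of Yᵢ has 8b candidates, of which fewer than 8b have been used since.

open import Defs hiding (sym)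
open import Data.Bool as Bool using (Bool; true; false; if_then_else_; _∧_; _∨_; not; T)
open import Data.Bool.Properties using (∧-zeroʳ; ∨-zeroʳ)
open import Data.Fin as Fin using (Fin; toℕ; fromℕ<; inject≤)
open import Data.Fin.Properties using (toℕ<n; toℕ-fromℕ<; toℕ-injective; inject≤-injective)
open import Data.Fin.Permutation using (Permutation′; _⟨$⟩ʳ_; _⟨$⟩ˡ_; inverseˡ; inverseʳ)
open import Data.List using (List; []; _∷_; _++_; map; length; allFin; cartesianProductWith; filter)
open import Data.List.Properties using (map-tabulate; length-tabulate; map-∘; map-++; map-cong; length-++; length-filter)
open import Data.Bool.ListAction using (all)
open import Data.Nat.ListAction using (sum)
open import Data.Nat.ListAction.Properties using (sum-++)
open import Data.List.Membership.Propositional using (_∈_)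
open import Data.List.Membership.Propositional.Properties using (∈-allFin; ∈-++⁻; ∈-++⁺ˡ; ∈-++⁺ʳ; ∈-filter⁺; ∈-filter⁻)
open import Data.List.Relation.Unary.Any using (here; there)
open import Data.Nat as ℕ using (ℕ; zero; suc; NonZero; _+_; _*_; _^_; _∸_; _≤_; _<_; _<ᵇ_; _≤ᵇ_; z≤n; s≤s; _/_; _%_; >-nonZero; >-nonZero⁻¹; ≢-nonZero; ∣_-_∣)
open import Data.Nat.Properties
open import Data.Nat.DivMod using (m≡m%n+[m/n]*n; m%n<n; m/n*n≤m)
open import Data.Integer as ℤ using ()
open import Data.Integer.Properties as ℤ using ()
open import Data.Rational as ℚ using (ℚ; Positive; 1ℚ)
open import Data.Rational.Properties as ℚ using ()
open import Data.Rational.Unnormalised as ℚᵘ using (mkℚᵘ; *≡*; *≤*)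
open import Data.Rational.Unnormalised.Properties as ℚᵘ using ()
open import Data.Rational.Solver using (module +-*-Solver)
open import Data.List.Extrema.Nat using (argmin; f[argmin]≤f[xs])
open import Data.List.Relation.Unary.All as All using ()
open import Data.Nat.Tactic.RingSolver using (solve-∀)
open import Data.Product using (Σ-syntax; _×_; _,_; proj₁; proj₂)
open import Data.Sum as Sum using (_⊎_; inj₁; inj₂)
open import Data.Empty using (⊥-elim)
open import Function using (_∘_; id)
open import Relation.Nullary.Decidable using (⌊_⌋)
open import Relation.Nullary using (¬_; yes; no; contradiction)
open import Relation.Binary.PropositionalEquality using (_≡_; _≢_; refl; sym; trans; cong; cong₂; subst; subst₂; module ≡-Reasoning)

-- One tuple cannot serve the whole embedding. If every degree in `G` is at least `m + d`, its core
-- is only guaranteed a share of about (d/n)^(2Δ) of the vertices, and `H` may be far larger, so the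
-- core is renewed at every stage. The neighbours of a vertex of Yᵢ are spread over two successive
-- X-layers, yet all their images must lie in the single core N(tᵢ) for its badness count to apply.
-- This is why Xᵢ goes into two cores at once, and why each new core has to meet what survives of
-- the old one. The overlap costs the density factor twice: it has at least (1/8)(d/n)^(4Δ) n
-- vertices. The greedy choice needs about ΔL + 2b of them, with L near 16b(n/d)^2. So b may be of
-- order (d/n)^(4Δ+2) n/Δ, and the assumed bound is of at most this order because d ≤ n and Δ ≥ 1.
-- Probability enters only as counting over all n^Δ tuples.

private variable
  I J : Set

-- Indicators of Booleans

χ : Bool → ℕ
χ c = if c then 1 else 0

χ≤1 : ∀ c → χ c ≤ 1
χ≤1 true = ≤-refl
χ≤1 false = z≤n

χ-∧ : ∀ c e → χ (c ∧ e) ≡ χ c * χ e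
χ-∧ true e = sym (+-identityʳ (χ e))
χ-∧ false e = refl

χ-mono : ∀ {c e} → (c ≡ true → e ≡ true) → χ c ≤ χ e
χ-mono {false} h = z≤n
χ-mono {true} {e} h rewrite h refl = ≤-refl

χ-reflects : ∀ {c k} → k < χ c → c ≡ true
χ-reflects {true} _ = refl

χ≡0 : ∀ {c} → χ c ≡ 0 → c ≡ false
χ≡0 {false} _ = refl

∧-split : ∀ {c e} → c ∧ e ≡ true → c ≡ true × e ≡ true
∧-split {true} {true} _ = refl , refl

∧-join : ∀ {c e} → c ≡ true → e ≡ true → c ∧ e ≡ true
∧-join refl refl = refl

all-lookup : (p : I → Bool) → ∀ {x xs} → all p xs ≡ true → x ∈ xs → p x ≡ true
all-lookup p h (here refl) = proj₁ (∧-split h)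
all-lookup p {xs = y ∷ xs} h (there x∈) = all-lookup p (proj₂ (∧-split {p y} h)) x∈

≡true⇒T : ∀ {c} → c ≡ true → T c
≡true⇒T refl = _

¬T⇒≡false : ∀ {c} → ¬ T c → c ≡ false
¬T⇒≡false {false} _ = refl
¬T⇒≡false {true} h = ⊥-elim (h _)

all-mono : {p q : I → Bool} → (∀ {x} → p x ≡ true → q x ≡ true) → ∀ xs → all p xs ≡ true → all q xs ≡ true
all-mono h [] _ = refl
all-mono {p = p} h (x ∷ xs) e with ∧-split {p x} e
... | px , pxs = ∧-join (h px) (all-mono h xs pxs)

all-zip : {p q r : I → Bool} → (∀ {x} → p x ≡ true → q x ≡ true → r x ≡ true) →
  ∀ xs → all p xs ≡ true → all q xs ≡ true → all r xs ≡ true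
all-zip h [] _ _ = refl
all-zip {p = p} {q} h (x ∷ xs) e e′ with ∧-split {p x} e | ∧-split {q x} e′
... | px , pxs | qx , qxs = ∧-join (h px qx) (all-zip h xs pxs qxs)

χ-mono₂ : ∀ {a b a′ b′} → (a ≡ true → b ≡ true → a′ ≡ true × b′ ≡ true) → χ a * χ b ≤ χ a′ * χ b′
χ-mono₂ {false} h = z≤n
χ-mono₂ {true} {false} h = z≤n
χ-mono₂ {true} {true} h with h refl refl
... | refl , refl = ≤-refl

χ-mono₃ : ∀ {a b c a′ b′ c′} →
  (a ≡ true → b ≡ true → c ≡ true → a′ ≡ true × b′ ≡ true × c′ ≡ true) →
  χ a * (χ b * χ c) ≤ χ a′ * (χ b′ * χ c′)
χ-mono₃ {false} h = z≤n
χ-mono₃ {true} {false} h = z≤n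
χ-mono₃ {true} {true} {false} h = z≤n
χ-mono₃ {true} {true} {true} h with h refl refl refl
... | refl , refl , refl = ≤-refl

-- Finite sums

∑ : List I → (I → ℕ) → ℕ
∑ xs f = sum (map f xs)

∑-mono : ∀ {f g : I → ℕ} → (∀ x → f x ≤ g x) → ∀ xs → ∑ xs f ≤ ∑ xs g
∑-mono h [] = z≤n
∑-mono h (x ∷ xs) = +-mono-≤ (h x) (∑-mono h xs)

∑-mono-< : ∀ {f g : I → ℕ} → (∀ x → f x ≤ g x) → ∀ {z xs} → z ∈ xs → f z < g z → ∑ xs f < ∑ xs g
∑-mono-< h {xs = x ∷ xs} (here refl) lt = +-mono-<-≤ lt (∑-mono h xs)
∑-mono-< h {xs = x ∷ xs} (there z∈) lt = +-mono-≤-< (h x) (∑-mono-< h z∈ lt)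

∑-cong : ∀ {f g : I → ℕ} → (∀ x → f x ≡ g x) → ∀ xs → ∑ xs f ≡ ∑ xs g
∑-cong h xs = cong sum (map-cong h xs)

∑-+ : ∀ (f g : I → ℕ) xs → ∑ xs (λ x → f x + g x) ≡ ∑ xs f + ∑ xs g
∑-+ f g [] = refl
∑-+ f g (x ∷ xs) rewrite ∑-+ f g xs = lemma (f x) (g x) (∑ xs f) (∑ xs g)
  where
  lemma : ∀ a b c d → a + b + (c + d) ≡ a + c + (b + d)
  lemma = solve-∀

∑-*ˡ : ∀ c (f : I → ℕ) xs → ∑ xs (λ x → c * f x) ≡ c * ∑ xs f
∑-*ˡ c f [] = sym (*-zeroʳ c)
∑-*ˡ c f (x ∷ xs) rewrite ∑-*ˡ c f xs = sym (*-distribˡ-+ c (f x) (∑ xs f))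

∑-*ʳ : ∀ c (f : I → ℕ) xs → ∑ xs (λ x → f x * c) ≡ ∑ xs f * c
∑-*ʳ c f xs = trans (∑-cong (λ x → *-comm (f x) c) xs) (trans (∑-*ˡ c f xs) (*-comm c (∑ xs f)))

∑-const : ∀ c (xs : List I) → ∑ xs (λ _ → c) ≡ length xs * c
∑-const c [] = refl
∑-const c (x ∷ xs) = cong (c +_) (∑-const c xs)

∑-swap : ∀ (f : I → J → ℕ) xs ys → ∑ xs (λ x → ∑ ys (f x)) ≡ ∑ ys (λ y → ∑ xs (λ x → f x y))
∑-swap f [] ys = sym (trans (∑-const 0 ys) (*-zeroʳ (length ys)))
∑-swap f (x ∷ xs) ys = trans (cong (∑ ys (f x) +_) (∑-swap f xs ys)) (sym (∑-+ (f x) _ ys))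

∑-product : ∀ (f : I → ℕ) (g : J → ℕ) xs ys → ∑ xs f * ∑ ys g ≡ ∑ xs (λ x → ∑ ys (λ y → f x * g y))
∑-product f g xs ys =
  trans (sym (∑-*ʳ (∑ ys g) f xs)) (∑-cong (λ x → sym (∑-*ˡ (f x) g ys)) xs)

∑-++ : ∀ (f : I → ℕ) xs ys → ∑ (xs ++ ys) f ≡ ∑ xs f + ∑ ys f
∑-++ f xs ys = trans (cong sum (map-++ f xs ys)) (sum-++ (map f xs) (map f ys))

∑≡0 : ∀ {f : I → ℕ} {z xs} → ∑ xs f ≡ 0 → z ∈ xs → f z ≡ 0
∑≡0 {f = f} {xs = x ∷ xs} h (here refl) = m+n≡0⇒m≡0 (f x) h
∑≡0 {f = f} {xs = x ∷ xs} h (there z∈) = ∑≡0 (m+n≡0⇒n≡0 (f x) h) z∈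

∑-pigeonhole : ∀ (f g : I → ℕ) xs → ∑ xs f < ∑ xs g → Σ[ x ∈ I ] f x < g x
∑-pigeonhole f g (x ∷ xs) h with f x <? g x
... | yes fx<gx = x , fx<gx
... | no fx≮gx = ∑-pigeonhole f g xs (≰⇒> λ le → <⇒≱ h (+-mono-≤ (≮⇒≥ fx≮gx) le))

-- Rearrangement, Chebyshev and power means

x∙yz≡y∙xz : ∀ x y z → x * (y * z) ≡ y * (x * z)
x∙yz≡y∙xz = solve-∀

^-distribʳ-* : ∀ k x y → (x * y) ^ k ≡ x ^ k * y ^ k
^-distribʳ-* zero x y = refl
^-distribʳ-* (suc k) x y rewrite ^-distribʳ-* k x y = lemma x y (x ^ k) (y ^ k)
  where
  lemma : ∀ a b c d → a * b * (c * d) ≡ a * c * (b * d)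
  lemma = solve-∀

-- The two sides differ by (y - x)(v - u), which is `e * r` after writing `y` as `x + e` and `v` as
-- `u + r`; this avoids subtraction in ℕ.
rearrangement : ∀ {x y u v} → x ≤ y → u ≤ v → x * v + y * u ≤ x * u + y * v
rearrangement {x} {y} {u} {v} x≤y u≤v with m≤n⇒∃[o]m+o≡n x≤y | m≤n⇒∃[o]m+o≡n u≤v
... | (e , refl) | (r , refl) = ≤-trans (m≤m+n _ (e * r)) (≤-reflexive (lemma x e u r))
  where
  lemma : ∀ x e u r → x * (u + r) + (x + e) * u + e * r ≡ x * u + (x + e) * (u + r)
  lemma = solve-∀

rearrangement-^ : ∀ k x y → x * y ^ k + y * x ^ k ≤ x ^ suc k + y ^ suc k
rearrangement-^ k x y with ≤-total x y
... | inj₁ x≤y = rearrangement x≤y (^-monoˡ-≤ k x≤y)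
... | inj₂ y≤x = subst₂ _≤_ (+-comm (y * x ^ k) _) (+-comm (y ^ suc k) _)
                   (rearrangement y≤x (^-monoˡ-≤ k y≤x))

∑∑-+ : ∀ (f g : I → J → ℕ) xs ys → ∑ xs (λ x → ∑ ys (λ y → f x y + g x y)) ≡
  ∑ xs (λ x → ∑ ys (f x)) + ∑ xs (λ x → ∑ ys (g x))
∑∑-+ f g xs ys = trans (∑-cong (λ x → ∑-+ (f x) (g x) ys) xs) (∑-+ _ _ xs)

-- Chebyshev's sum inequality for the similarly ordered families f and f^k. It is `rearrangement-^`
-- summed over all ordered pairs; each product then occurs twice, hence the cancelled factor 2.
∑-chebyshev : ∀ k (f : I → ℕ) xs →
  ∑ xs f * ∑ xs (λ x → f x ^ k) ≤ length xs * ∑ xs (λ x → f x ^ suc k)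
∑-chebyshev k f xs = *-cancelˡ-≤ 2 (begin
  2 * (∑ xs f * ∑ xs fᵏ)
    ≡⟨ double (∑ xs f * ∑ xs fᵏ) ⟩
  ∑ xs f * ∑ xs fᵏ + ∑ xs f * ∑ xs fᵏ
    ≡⟨ cong₂ _+_ (∑-product f fᵏ xs xs) (trans (∑-product f fᵏ xs xs) (∑-swap _ xs xs)) ⟩
  ∑ xs (λ x → ∑ xs (λ y → f x * fᵏ y)) + ∑ xs (λ x → ∑ xs (λ y → f y * fᵏ x))
    ≡⟨ ∑∑-+ (λ x y → f x * fᵏ y) (λ x y → f y * fᵏ x) xs xs ⟨
  ∑ xs (λ x → ∑ xs (λ y → f x * fᵏ y + f y * fᵏ x))
    ≤⟨ ∑-mono (λ x → ∑-mono (λ y → rearrangement-^ k (f x) (f y)) xs) xs ⟩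
  ∑ xs (λ x → ∑ xs (λ y → fᵏ⁺¹ x + fᵏ⁺¹ y))
    ≡⟨ ∑∑-+ (λ x _ → fᵏ⁺¹ x) (λ _ y → fᵏ⁺¹ y) xs xs ⟩
  ∑ xs (λ x → ∑ xs (λ y → fᵏ⁺¹ x)) + ∑ xs (λ x → ∑ xs fᵏ⁺¹)
    ≡⟨ cong₂ _+_ (trans (∑-swap _ xs xs) (∑-const _ xs)) (∑-const _ xs) ⟩
  length xs * ∑ xs fᵏ⁺¹ + length xs * ∑ xs fᵏ⁺¹
    ≡⟨ double (length xs * ∑ xs fᵏ⁺¹) ⟨
  2 * (length xs * ∑ xs fᵏ⁺¹) ∎)
  where
  open ≤-Reasoning
  fᵏ fᵏ⁺¹ : _ → ℕ
  fᵏ x = f x ^ k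
  fᵏ⁺¹ x = f x ^ suc k
  double : ∀ a → 2 * a ≡ a + a
  double = solve-∀

-- Jensen's inequality for the k-th power, without division. Each induction step is one application
-- of Chebyshev.
power-mean : ∀ k (f : I → ℕ) xs →
  length xs * ∑ xs f ^ k ≤ length xs ^ k * ∑ xs (λ x → f x ^ k)
power-mean zero f xs = ≤-reflexive (trans (sym (∑-const 1 xs)) (sym (+-identityʳ _)))
power-mean (suc k) f xs = begin
  ℓ * (S * S ^ k)      ≡⟨ x∙yz≡y∙xz ℓ S (S ^ k) ⟩
  S * (ℓ * S ^ k)      ≤⟨ *-monoʳ-≤ S (power-mean k f xs) ⟩
  S * (ℓ ^ k * Sₖ)     ≡⟨ x∙yz≡y∙xz S (ℓ ^ k) Sₖ ⟩
  ℓ ^ k * (S * Sₖ)     ≤⟨ *-monoʳ-≤ (ℓ ^ k) (∑-chebyshev k f xs) ⟩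
  ℓ ^ k * (ℓ * Sₖ₊₁)   ≡⟨ lemma (ℓ ^ k) ℓ Sₖ₊₁ ⟩
  ℓ * ℓ ^ k * Sₖ₊₁     ∎
  where
  open ≤-Reasoning
  ℓ S Sₖ Sₖ₊₁ : ℕ
  ℓ = length xs
  S = ∑ xs f
  Sₖ = ∑ xs (λ x → f x ^ k)
  Sₖ₊₁ = ∑ xs (λ x → f x ^ suc k)
  lemma : ∀ a b c → a * (b * c) ≡ b * a * c
  lemma = solve-∀

-- Subsets and tuples of Fin n

card : ∀ {n} → (Fin n → Bool) → ℕ
card S = ∑ (allFin _) (χ ∘ S)

_∩_ : ∀ {n} → (Fin n → Bool) → (Fin n → Bool) → Fin n → Bool
(S ∩ S′) v = S v ∧ S′ v

infixr 7 _∩_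

card-mono : ∀ {n} {S S′ : Fin n → Bool} → (∀ v → S v ≡ true → S′ v ≡ true) → card S ≤ card S′
card-mono h = ∑-mono (λ v → χ-mono (h v)) (allFin _)

∑-allFin-const : ∀ n c → ∑ (allFin n) (λ _ → c) ≡ n * c
∑-allFin-const n c = trans (∑-const c (allFin n)) (cong (_* c) (length-tabulate {n = n} id))

card≤n : ∀ {n} (S : Fin n → Bool) → card S ≤ n
card≤n {n} S = begin
  card S                    ≤⟨ ∑-mono (λ v → χ≤1 (S v)) (allFin n) ⟩
  ∑ (allFin n) (λ _ → 1)    ≡⟨ ∑-allFin-const n 1 ⟩
  n * 1                     ≡⟨ *-identityʳ n ⟩
  n                         ∎
  where open ≤-Reasoning

card-pick : ∀ {n} (S : Fin n → Bool) → 0 < card S → Σ[ v ∈ Fin n ] S v ≡ true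
card-pick {n} S h with ∑-pigeonhole (λ _ → 0) (χ ∘ S) (allFin n)
                         (subst (_< card S) (sym (trans (∑-allFin-const n 0) (*-zeroʳ n))) h)
... | v , lt = v , χ-reflects lt

_≡ᵇ_ : ∀ {n} → Fin n → Fin n → Bool
u ≡ᵇ v = ⌊ u Fin.≟ v ⌋

∑-allFin-suc : ∀ {n} (f : Fin (suc n) → ℕ) →
  ∑ (allFin (suc n)) f ≡ f Fin.zero + ∑ (allFin n) (f ∘ Fin.suc)
∑-allFin-suc f =
  cong (λ l → f Fin.zero + sum l) (trans (map-tabulate Fin.suc f) (sym (map-tabulate id (f ∘ Fin.suc))))

card-singleton : ∀ {n} (v : Fin n) → card (_≡ᵇ v) ≤ 1
card-singleton {suc n} v = subst (_≤ 1) (sym (∑-allFin-suc (λ u → χ (u ≡ᵇ v)))) (go v)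
  where
  go : ∀ v → χ (Fin.zero ≡ᵇ v) + ∑ (allFin n) (λ u → χ (Fin.suc u ≡ᵇ v)) ≤ 1
  go Fin.zero = s≤s (≤-reflexive (trans (∑-allFin-const n 0) (*-zeroʳ n)))
  go (Fin.suc v) = ≤-trans (∑-mono (λ u → χ-mono (suc-injᵇ u)) (allFin n)) (card-singleton v)
    where
    suc-injᵇ : ∀ u → (Fin.suc u ≡ᵇ Fin.suc v) ≡ true → (u ≡ᵇ v) ≡ true
    suc-injᵇ u h with u Fin.≟ v
    ... | yes _ = refl

tuples : ∀ n → ℕ → List (List (Fin n))
tuples n zero = [] ∷ []
tuples n (suc k) = cartesianProductWith _∷_ (allFin n) (tuples n k)

∑-cartesianProductWith : ∀ {A B C : Set} (h : A → B → C) (f : C → ℕ) xs ys →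
  ∑ (cartesianProductWith h xs ys) f ≡ ∑ xs (λ x → ∑ ys (λ y → f (h x y)))
∑-cartesianProductWith h f [] ys = refl
∑-cartesianProductWith h f (x ∷ xs) ys =
  trans (∑-++ f (map (h x) ys) _)
    (cong₂ _+_ (cong sum (sym (map-∘ ys))) (∑-cartesianProductWith h f xs ys))

∑-tuples-all : ∀ {n} (p : Fin n → Bool) k → ∑ (tuples n k) (λ t → χ (all p t)) ≡ card p ^ k
∑-tuples-all p zero = refl
∑-tuples-all {n} p (suc k) = let open ≡-Reasoning in begin
  ∑ (tuples n (suc k)) (λ t → χ (all p t))
    ≡⟨ ∑-cartesianProductWith _∷_ _ (allFin n) (tuples n k) ⟩
  ∑ (allFin n) (λ v → ∑ (tuples n k) (λ t → χ (p v ∧ all p t)))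
    ≡⟨ ∑-cong (λ v → ∑-cong (λ t → χ-∧ (p v) (all p t)) (tuples n k)) (allFin n) ⟩
  ∑ (allFin n) (λ v → ∑ (tuples n k) (λ t → χ (p v) * χ (all p t)))
    ≡⟨ ∑-product _ _ (allFin n) (tuples n k) ⟨
  card p * ∑ (tuples n k) (λ t → χ (all p t))
    ≡⟨ cong (card p *_) (∑-tuples-all p k) ⟩
  card p * card p ^ k ∎

∑-tuples-const : ∀ n k c → ∑ (tuples n k) (λ _ → c) ≡ n ^ k * c
∑-tuples-const n zero c = refl
∑-tuples-const n (suc k) c = let open ≡-Reasoning in begin
  ∑ (tuples n (suc k)) (λ _ → c)
    ≡⟨ ∑-cartesianProductWith _∷_ _ (allFin n) (tuples n k) ⟩
  ∑ (allFin n) (λ _ → ∑ (tuples n k) (λ _ → c))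
    ≡⟨ ∑-allFin-const n _ ⟩
  n * ∑ (tuples n k) (λ _ → c)
    ≡⟨ cong (n *_) (∑-tuples-const n k c) ⟩
  n * (n ^ k * c)
    ≡⟨ *-assoc n (n ^ k) c ⟨
  n ^ suc k * c ∎

-- Gates

-- The core is N(t) ∩ U for a tuple t. A vertex with k unplaced neighbours stays embeddable as long
-- as the list of images of its placed neighbours is not bad at level k: by step, all but L core
-- vertices extend such a list to one that is not bad at level k - 1.

common : ∀ {n} → Graph n → (Fin n → Bool) → List (Fin n) → Fin n → Bool
common G U s w = U w ∧ all (λ v → adj G v w) s

record Gate {n} (G : Graph n) (Δ L g : ℕ) (U : Fin n → Bool) : Set where
  field
    core  : Fin n → Bool
    bad   : ℕ → List (Fin n) → Bool
    core⊆ : ∀ v → core v ≡ true → U v ≡ true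
    start : bad Δ [] ≡ false
    step  : ∀ k s → bad (suc k) s ≡ false → card (core ∩ (λ v → bad k (v ∷ s))) ≤ L
    rich  : ∀ k s → bad k s ≡ false → g ≤ card (common G U s)

-- Dependent random choice, by counting tuples

module GateExistence {n} (G : Graph n) (Δ L g : ℕ) (U : Fin n → Bool) where

  V : List (Fin n)
  V = allFin n

  core : List (Fin n) → Fin n → Bool
  core t v = U v ∧ all (adj G v) t

  -- A threshold at every level takes the place of a count of bad Δ-tuples. It is the form in which
  -- a greedy embedding can use that count: one vertex at a time, at most `L` forbidden choices
  -- each.
  bad : List (Fin n) → ℕ → List (Fin n) → Bool
  bad t zero s = card (common G U s) <ᵇ g
  bad t (suc k) s = L ≤ᵇ card (core t ∩ (λ v → bad t k (v ∷ s)))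

  inside : List (Fin n) → Bool
  inside = all (common G U [])

  common-∷ : ∀ {v s w} → common G U s w ≡ true → adj G v w ≡ true → common G U (v ∷ s) w ≡ true
  common-∷ {v} {s} {w} h vw with ∧-split {U w} h
  ... | Uw , hs = ∧-join Uw (∧-join vw hs)

  common-anti : ∀ {v s w} → common G U (v ∷ s) w ≡ true → common G U s w ≡ true
  common-anti {v} {s} {w} h with ∧-split {U w} h
  ... | Uw , hs = ∧-join Uw (proj₂ (∧-split {adj G v w} hs))

  -- Double counting, by induction on `k`. At level 0 a bad `s` has fewer than `g` common neighbours
  -- in `U`, so at most `g ^ Δ` tuples lie among them. At level `suc k` every counted `t` has at
  -- least `L` core vertices `v` with `v ∷ s` bad at level `k`. Such a `v` is adjacent to all of
  -- `t`, so `t` also lies in the common neighbourhood of `v ∷ s` and is counted there; there are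
  -- `n` possible `v`.
  bad-count : ∀ k s →
    L ^ k * ∑ (tuples n Δ) (λ t → χ (all (common G U s) t ∧ bad t k s)) ≤ n ^ k * g ^ Δ
  bad-count zero s = *-monoʳ-≤ 1 bound
    where
    open ≤-Reasoning
    bound : ∑ (tuples n Δ) (λ t → χ (all (common G U s) t ∧ (card (common G U s) <ᵇ g))) ≤ g ^ Δ
    bound with card (common G U s) <? g
    ... | yes few = begin
      ∑ (tuples n Δ) (λ t → χ (all (common G U s) t ∧ (card (common G U s) <ᵇ g)))
        ≤⟨ ∑-mono (λ t → χ-mono (λ h → proj₁ (∧-split h))) (tuples n Δ) ⟩
      ∑ (tuples n Δ) (λ t → χ (all (common G U s) t))
        ≡⟨ ∑-tuples-all (common G U s) Δ ⟩
      card (common G U s) ^ Δ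
        ≤⟨ ^-monoˡ-≤ Δ (<⇒≤ few) ⟩
      g ^ Δ ∎
    ... | no many = begin
      ∑ (tuples n Δ) (λ t → χ (all (common G U s) t ∧ (card (common G U s) <ᵇ g)))
        ≤⟨ ∑-mono (λ t → χ-mono {e = false} (λ h → contradiction
             (<ᵇ⇒< _ _ (≡true⇒T (proj₂ (∧-split {all (common G U s) t} h)))) many)) (tuples n Δ) ⟩
      ∑ (tuples n Δ) (λ _ → 0)
        ≡⟨ trans (∑-tuples-const n Δ 0) (*-zeroʳ (n ^ Δ)) ⟩
      0
        ≤⟨ z≤n ⟩
      g ^ Δ ∎
  bad-count (suc k) s = begin
    L * L ^ k * ∑ (tuples n Δ) (hit (suc k) s)
      ≡⟨ lemma L (L ^ k) _ ⟩
    L ^ k * (L * ∑ (tuples n Δ) (hit (suc k) s))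
      ≡⟨ cong (L ^ k *_) (∑-*ˡ L (hit (suc k) s) (tuples n Δ)) ⟨
    L ^ k * ∑ (tuples n Δ) (λ t → L * hit (suc k) s t)
      ≤⟨ *-monoʳ-≤ (L ^ k) (∑-mono pointwise (tuples n Δ)) ⟩
    L ^ k * ∑ (tuples n Δ) (λ t → ∑ V (λ v → hit k (v ∷ s) t))
      ≡⟨ cong (L ^ k *_) (∑-swap (λ t v → hit k (v ∷ s) t) (tuples n Δ) V) ⟩
    L ^ k * ∑ V (λ v → ∑ (tuples n Δ) (hit k (v ∷ s)))
      ≡⟨ ∑-*ˡ (L ^ k) _ V ⟨
    ∑ V (λ v → L ^ k * ∑ (tuples n Δ) (hit k (v ∷ s)))
      ≤⟨ ∑-mono (λ v → bad-count k (v ∷ s)) V ⟩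
    ∑ V (λ _ → n ^ k * g ^ Δ)
      ≡⟨ ∑-allFin-const n _ ⟩
    n * (n ^ k * g ^ Δ)
      ≡⟨ *-assoc n (n ^ k) (g ^ Δ) ⟨
    n ^ suc k * g ^ Δ ∎
    where
    open ≤-Reasoning
    hit : ℕ → List (Fin n) → List (Fin n) → ℕ
    hit k s t = χ (all (common G U s) t ∧ bad t k s)
    lemma : ∀ a b c → a * b * c ≡ b * (a * c)
    lemma = solve-∀
    pointwise : ∀ t → L * hit (suc k) s t ≤ ∑ V (λ v → hit k (v ∷ s) t)
    pointwise t with all (common G U s) t in t⊆ | L ≤? card (core t ∩ (λ v → bad t k (v ∷ s)))
    ... | false | _ = ≤-trans (≤-reflexive (*-zeroʳ L)) z≤n
    ... | true | no few = ≤-trans (≤-reflexive (trans (cong (λ e → L * χ e) not-bad) (*-zeroʳ L))) z≤n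
      where
      not-bad : bad t (suc k) s ≡ false
      not-bad = ¬T⇒≡false (λ h → few (≤ᵇ⇒≤ _ _ h))
    ... | true | yes many = begin
      L * χ (bad t (suc k) s)    ≤⟨ *-monoʳ-≤ L (χ≤1 _) ⟩
      L * 1                      ≡⟨ *-identityʳ L ⟩
      L                          ≤⟨ many ⟩
      card (core t ∩ (λ v → bad t k (v ∷ s)))
        ≤⟨ ∑-mono (λ v → χ-mono (enlarge v)) V ⟩
      ∑ V (λ v → hit k (v ∷ s) t) ∎
      where
      enlarge : ∀ v → core t v ∧ bad t k (v ∷ s) ≡ true →
        all (common G U (v ∷ s)) t ∧ bad t k (v ∷ s) ≡ true
      enlarge v h with ∧-split {core t v} h
      ... | in-core , is-bad with ∧-split {U v} in-core
      ... | _ , adjacent = ∧-join (all-zip (common-∷ {s = s}) t t⊆ adjacent) is-bad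

  module _ (C : Fin n → Bool) (C⊆U : ∀ v → C v ≡ true → U v ≡ true)
           (d : ℕ) (deg : ∀ v → d ≤ card (adj G v ∩ U)) where

    codegree : Fin n → Fin n → ℕ
    codegree c u = card (common G U (c ∷ u ∷ []))

    -- Paths c, w, u with w and u in `U`: at least `d` choices of w, then at least `d` of u.
    ∑-codegree : ∀ c → d * d ≤ ∑ V (λ u → χ (U u) * codegree c u)
    ∑-codegree c = begin
      d * d
        ≤⟨ *-monoˡ-≤ d (deg c) ⟩
      card (adj G c ∩ U) * d
        ≡⟨ ∑-*ʳ d _ V ⟨
      ∑ V (λ w → χ ((adj G c ∩ U) w) * d)
        ≤⟨ ∑-mono (λ w → *-monoʳ-≤ (χ ((adj G c ∩ U) w)) (deg w)) V ⟩
      ∑ V (λ w → χ ((adj G c ∩ U) w) * card (adj G w ∩ U))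
        ≡⟨ ∑-cong (λ w → ∑-*ˡ (χ ((adj G c ∩ U) w)) _ V) V ⟨
      ∑ V (λ w → ∑ V (λ u → χ ((adj G c ∩ U) w) * χ ((adj G w ∩ U) u)))
        ≤⟨ ∑-mono (λ w → ∑-mono (λ u → pointwise w u) V) V ⟩
      ∑ V (λ w → ∑ V (λ u → χ (U u) * χ (common G U (c ∷ u ∷ []) w)))
        ≡⟨ ∑-swap _ V V ⟩
      ∑ V (λ u → ∑ V (λ w → χ (U u) * χ (common G U (c ∷ u ∷ []) w)))
        ≡⟨ ∑-cong (λ u → ∑-*ˡ (χ (U u)) _ V) V ⟩
      ∑ V (λ u → χ (U u) * codegree c u) ∎
      where
      open ≤-Reasoning
      pointwise : ∀ w u →
        χ ((adj G c ∩ U) w) * χ ((adj G w ∩ U) u) ≤ χ (U u) * χ (common G U (c ∷ u ∷ []) w)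
      pointwise w u = χ-mono₂ λ cw wu →
        let (cw , Uw) = ∧-split {adj G c w} cw
            (wu , Uu) = ∧-split {adj G w u} wu
        in Uu , ∧-join Uw (∧-join cw (∧-join (trans (Graph.sym G u w) wu) refl))

    -- Averaging the product of the two sizes lets one tuple make both large. The factor `inside`
    -- discards tuples that leave `U`, which `bad-count` does not control.
    yield : List (Fin n) → ℕ
    yield t = χ (inside t) * (card (core t ∩ C) * card (core t))

    -- For c in `C` and u in `U`, exactly `codegree c u ^ Δ` tuples lie in the common neighbourhood
    -- of c and u, and each of them has c in `core t ∩ C` and u in `core t`. Jensen over u, for
    -- every c separately, then brings in `∑-codegree`.
    ∑-yield : .{{_ : NonZero Δ}} → card C * (n * (d * d) ^ Δ) ≤ n ^ Δ * ∑ (tuples n Δ) yield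
    ∑-yield = begin
      card C * (n * (d * d) ^ Δ)
        ≡⟨ ∑-*ʳ _ _ V ⟨
      ∑ V (λ c → χ (C c) * (n * (d * d) ^ Δ))
        ≤⟨ ∑-mono (λ c → *-monoʳ-≤ (χ (C c)) (per-vertex c)) V ⟩
      ∑ V (λ c → χ (C c) * (n ^ Δ * ∑ V (λ u → χ (U u) * codegree c u ^ Δ)))
        ≡⟨ ∑-cong (λ c → x∙yz≡y∙xz (χ (C c)) (n ^ Δ) _) V ⟩
      ∑ V (λ c → n ^ Δ * (χ (C c) * ∑ V (λ u → χ (U u) * codegree c u ^ Δ)))
        ≡⟨ ∑-*ˡ (n ^ Δ) _ V ⟩
      n ^ Δ * ∑ V (λ c → χ (C c) * ∑ V (λ u → χ (U u) * codegree c u ^ Δ))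
        ≡⟨ cong (n ^ Δ *_) (∑-cong expand V) ⟩
      n ^ Δ * ∑ V (λ c → ∑ V (λ u → ∑ (tuples n Δ) (term c u)))
        ≡⟨ cong (n ^ Δ *_) (∑-cong (λ c → ∑-swap _ V (tuples n Δ)) V) ⟩
      n ^ Δ * ∑ V (λ c → ∑ (tuples n Δ) (λ t → ∑ V (λ u → term c u t)))
        ≡⟨ cong (n ^ Δ *_) (∑-swap _ V (tuples n Δ)) ⟩
      n ^ Δ * ∑ (tuples n Δ) (λ t → ∑ V (λ c → ∑ V (λ u → term c u t)))
        ≤⟨ *-monoʳ-≤ (n ^ Δ) (∑-mono collect (tuples n Δ)) ⟩
      n ^ Δ * ∑ (tuples n Δ) yield ∎
      where
      open ≤-Reasoning
      term : Fin n → Fin n → List (Fin n) → ℕ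
      term c u t = χ (C c) * (χ (U u) * χ (all (common G U (c ∷ u ∷ [])) t))
      -- The exponent must be positive: for `k = 0` and `e = false` the left side would be 1 and the
      -- right side 0.
      χ^ : ∀ e x k → .{{_ : NonZero k}} → (χ e * x) ^ k ≤ χ e * x ^ k
      χ^ true x k = ≤-reflexive (trans (cong (_^ k) (*-identityˡ x)) (sym (*-identityˡ (x ^ k))))
      χ^ false x (suc k) = z≤n
      per-vertex : ∀ c → n * (d * d) ^ Δ ≤ n ^ Δ * ∑ V (λ u → χ (U u) * codegree c u ^ Δ)
      per-vertex c = begin
        n * (d * d) ^ Δ
          ≤⟨ *-monoʳ-≤ n (^-monoˡ-≤ Δ (∑-codegree c)) ⟩
        n * ∑ V (λ u → χ (U u) * codegree c u) ^ Δ
          ≤⟨ subst (λ ℓ → ℓ * ∑ V weight ^ Δ ≤ ℓ ^ Δ * ∑ V (λ u → weight u ^ Δ))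
               (length-tabulate {n = n} id) (power-mean Δ weight V) ⟩
        n ^ Δ * ∑ V (λ u → (χ (U u) * codegree c u) ^ Δ)
          ≤⟨ *-monoʳ-≤ (n ^ Δ) (∑-mono (λ u → χ^ (U u) (codegree c u) Δ) V) ⟩
        n ^ Δ * ∑ V (λ u → χ (U u) * codegree c u ^ Δ) ∎
        where
        weight : Fin n → ℕ
        weight u = χ (U u) * codegree c u
      expand : ∀ c → χ (C c) * ∑ V (λ u → χ (U u) * codegree c u ^ Δ) ≡
                     ∑ V (λ u → ∑ (tuples n Δ) (term c u))
      expand c = trans (sym (∑-*ˡ (χ (C c)) _ V)) (∑-cong (λ u →
        trans (cong (λ e → χ (C c) * (χ (U u) * e)) (sym (∑-tuples-all (common G U (c ∷ u ∷ [])) Δ)))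
          (trans (cong (χ (C c) *_) (sym (∑-*ˡ (χ (U u)) _ (tuples n Δ))))
            (sym (∑-*ˡ (χ (C c)) _ (tuples n Δ))))) V)
      collect : ∀ t → ∑ V (λ c → ∑ V (λ u → term c u t)) ≤ yield t
      collect t = begin
        ∑ V (λ c → ∑ V (λ u → term c u t))
          ≤⟨ ∑-mono (λ c → ∑-mono (λ u → pointwise c u) V) V ⟩
        ∑ V (λ c → ∑ V (λ u → χ (inside t) * (χ ((core t ∩ C) c) * χ (core t u))))
          ≡⟨ ∑-cong (λ c → ∑-*ˡ (χ (inside t)) _ V) V ⟩
        ∑ V (λ c → χ (inside t) * ∑ V (λ u → χ ((core t ∩ C) c) * χ (core t u)))
          ≡⟨ ∑-*ˡ (χ (inside t)) _ V ⟩
        χ (inside t) * ∑ V (λ c → ∑ V (λ u → χ ((core t ∩ C) c) * χ (core t u)))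
          ≡⟨ cong (χ (inside t) *_) (∑-product _ _ V V) ⟨
        yield t ∎
        where
        pointwise : ∀ c u → term c u t ≤ χ (inside t) * (χ ((core t ∩ C) c) * χ (core t u))
        pointwise c u = χ-mono₃ λ Cc Uu h →
            all-mono (λ {w} e → ∧-join (proj₁ (∧-split {U w} e)) refl) t h
          , ∧-join (∧-join (C⊆U c Cc) (all-mono (λ {w} e →
              proj₁ (∧-split (proj₂ (∧-split {U w} e)))) t h)) Cc
          , ∧-join Uu (all-mono (λ {w} e →
              proj₁ (∧-split (proj₂ (∧-split {adj G c w} (proj₂ (∧-split {U w} e)))))) t h)

    -- The first hypothesis makes bad tuples so rare that penalising them leaves half of the average
    -- yield. The second makes the core at least as large as `L`, so a list that is not bad always
    -- extends. As the factors of the yield are at most `card C` and `n`, a bound on the product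
    -- bounds each of them below.
    gate-exists : .{{_ : NonZero Δ}} → .{{_ : NonZero n}} → .{{_ : NonZero (card C)}} →
      2 * (n * n * g) < L * (d * d) → 2 * (n * n) ^ Δ * L ≤ (d * d) ^ Δ * n →
      Σ[ γ ∈ Gate G Δ L g U ] (d * d) ^ Δ * n ≤ 2 * (n * n) ^ Δ * card (Gate.core γ) ×
        (d * d) ^ Δ * card C ≤ 2 * (n * n) ^ Δ * card (Gate.core γ ∩ C)
    gate-exists g-small L-small = from-tuple (∑-pigeonhole lower upper (tuples n Δ) averages)
      where
      D N c : ℕ
      D = (d * d) ^ Δ
      N = (n * n) ^ Δ
      c = card C

      hit : List (Fin n) → ℕ
      hit t = χ (inside t ∧ bad t Δ [])

      -- The penalty `2 * N * (c * n)` for a hit is at least every value of `upper`, so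
      -- `lower t < upper t` excludes hits; a tuple leaving `U` is excluded because its yield is 0.
      lower upper : List (Fin n) → ℕ
      lower t = c * n * D + hit t * (2 * N * (c * n))
      upper t = 2 * N * yield t

      instance
        n^Δ≢0 : NonZero (n ^ Δ)
        n^Δ≢0 = m^n≢0 n Δ
        N≢0 : NonZero N
        N≢0 = m^n≢0 (n * n) Δ {{m*n≢0 n n}}
        2N≢0 : NonZero (2 * N)
        2N≢0 = m*n≢0 2 N
        cn≢0 : NonZero (c * n)
        cn≢0 = m*n≢0 c n

      -- All penalties together stay below half of what `∑-yield` guarantees. This is `bad-count` at
      -- the empty list, with the factor 2 absorbed into 2^Δ.
      few-hits : 2 * N * ∑ (tuples n Δ) hit < n ^ Δ * D
      few-hits = *-cancelˡ-< (L ^ Δ) _ _ (begin-strict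
        L ^ Δ * (2 * N * ∑ (tuples n Δ) hit)
          ≡⟨ x∙yz≡y∙xz (L ^ Δ) (2 * N) _ ⟩
        2 * N * (L ^ Δ * ∑ (tuples n Δ) hit)
          ≤⟨ *-monoʳ-≤ (2 * N) (bad-count Δ []) ⟩
        2 * N * (n ^ Δ * g ^ Δ)
          ≡⟨ regroup N (n ^ Δ) (g ^ Δ) ⟩
        n ^ Δ * (2 * (N * g ^ Δ))
          ≡⟨ cong (λ e → n ^ Δ * (2 * e)) (^-distribʳ-* Δ (n * n) g) ⟨
        n ^ Δ * (2 * (n * n * g) ^ Δ)
          ≤⟨ *-monoʳ-≤ (n ^ Δ) (*-monoˡ-≤ ((n * n * g) ^ Δ) (2≤2^ Δ)) ⟩
        n ^ Δ * (2 ^ Δ * (n * n * g) ^ Δ)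
          ≡⟨ cong (n ^ Δ *_) (^-distribʳ-* Δ 2 (n * n * g)) ⟨
        n ^ Δ * (2 * (n * n * g)) ^ Δ
          <⟨ *-monoʳ-< (n ^ Δ) (^-monoˡ-< Δ g-small) ⟩
        n ^ Δ * (L * (d * d)) ^ Δ
          ≡⟨ cong (n ^ Δ *_) (^-distribʳ-* Δ L (d * d)) ⟩
        n ^ Δ * (L ^ Δ * D)
          ≡⟨ x∙yz≡y∙xz (n ^ Δ) (L ^ Δ) D ⟩
        L ^ Δ * (n ^ Δ * D) ∎)
        where
        open ≤-Reasoning
        regroup : ∀ x y z → 2 * x * (y * z) ≡ y * (2 * (x * z))
        regroup = solve-∀
        2≤2^ : ∀ k → .{{_ : NonZero k}} → 2 ≤ 2 ^ k
        2≤2^ k = ^-monoʳ-≤ 2 (>-nonZero⁻¹ k)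

      averages : ∑ (tuples n Δ) lower < ∑ (tuples n Δ) upper
      averages = begin-strict
        ∑ (tuples n Δ) lower
          ≡⟨ ∑-+ _ _ (tuples n Δ) ⟩
        ∑ (tuples n Δ) (λ _ → c * n * D) + ∑ (tuples n Δ) (λ t → hit t * (2 * N * (c * n)))
          ≡⟨ cong₂ _+_ (∑-tuples-const n Δ _) (∑-*ʳ _ hit (tuples n Δ)) ⟩
        n ^ Δ * (c * n * D) + ∑ (tuples n Δ) hit * (2 * N * (c * n))
          ≡⟨ cong₂ _+_ (x∙yz≡y∙xz (n ^ Δ) (c * n) D) (pull′ (∑ (tuples n Δ) hit) (2 * N) (c * n)) ⟩
        c * n * (n ^ Δ * D) + c * n * (2 * N * ∑ (tuples n Δ) hit)
          <⟨ +-monoʳ-< (c * n * (n ^ Δ * D)) (*-monoʳ-< (c * n) few-hits) ⟩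
        c * n * (n ^ Δ * D) + c * n * (n ^ Δ * D)
          ≡⟨ twice c n (n ^ Δ) D ⟩
        2 * n ^ Δ * (c * (n * D))
          ≤⟨ *-monoʳ-≤ (2 * n ^ Δ) ∑-yield ⟩
        2 * n ^ Δ * (n ^ Δ * ∑ (tuples n Δ) yield)
          ≡⟨ square (n ^ Δ) _ ⟩
        2 * (n ^ Δ * n ^ Δ) * ∑ (tuples n Δ) yield
          ≡⟨ cong (λ e → 2 * e * ∑ (tuples n Δ) yield) (^-distribʳ-* Δ n n) ⟨
        2 * N * ∑ (tuples n Δ) yield
          ≡⟨ ∑-*ˡ (2 * N) yield (tuples n Δ) ⟨
        ∑ (tuples n Δ) upper ∎
        where
        open ≤-Reasoning
        pull′ : ∀ x y z → x * (y * z) ≡ z * (y * x)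
        pull′ = solve-∀
        twice : ∀ x y z w → x * y * (z * w) + x * y * (z * w) ≡ 2 * z * (x * (y * w))
        twice = solve-∀
        square : ∀ x y → 2 * x * (x * y) ≡ 2 * (x * x) * y
        square = solve-∀

      from-tuple : Σ[ t ∈ List (Fin n) ] lower t < upper t →
        Σ[ γ ∈ Gate G Δ L g U ] D * n ≤ 2 * N * card (Gate.core γ) ×
          D * c ≤ 2 * N * card (Gate.core γ ∩ C)
      from-tuple (t , lt) = gate , core-large , core∩C-large
        where
        open ≤-Reasoning
        x y : ℕ
        x = card (core t ∩ C)
        y = card (core t)

        x≤c : x ≤ c
        x≤c = card-mono (λ v h → proj₂ (∧-split {core t v} h))

        yield≤ : yield t ≤ x * y
        yield≤ = ≤-trans (*-monoˡ-≤ (x * y) (χ≤1 (inside t))) (≤-reflexive (*-identityˡ (x * y)))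

        large : c * n * D ≤ 2 * N * (x * y)
        large = begin
          c * n * D        ≤⟨ m≤m+n _ _ ⟩
          lower t          ≤⟨ <⇒≤ lt ⟩
          2 * N * yield t  ≤⟨ *-monoʳ-≤ (2 * N) yield≤ ⟩
          2 * N * (x * y)  ∎

        core-large : D * n ≤ 2 * N * y
        core-large = *-cancelˡ-≤ c (begin
          c * (D * n)        ≡⟨ shuffle c D n ⟩
          c * n * D          ≤⟨ large ⟩
          2 * N * (x * y)    ≤⟨ *-monoʳ-≤ (2 * N) (*-monoˡ-≤ y x≤c) ⟩
          2 * N * (c * y)    ≡⟨ x∙yz≡y∙xz (2 * N) c y ⟩
          c * (2 * N * y)    ∎)
          where
          shuffle : ∀ x y z → x * (y * z) ≡ x * z * y
          shuffle = solve-∀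

        core∩C-large : D * c ≤ 2 * N * x
        core∩C-large = *-cancelʳ-≤ _ _ n (begin
          D * c * n          ≡⟨ shuffle D c n ⟩
          c * n * D          ≤⟨ large ⟩
          2 * N * (x * y)    ≤⟨ *-monoʳ-≤ (2 * N) (*-monoʳ-≤ x (card≤n (core t))) ⟩
          2 * N * (x * n)    ≡⟨ *-assoc (2 * N) x n ⟨
          2 * N * x * n      ∎)
          where
          shuffle : ∀ x y z → x * y * z ≡ y * z * x
          shuffle = solve-∀

        L≤core : L ≤ y
        L≤core = *-cancelˡ-≤ (2 * N) (≤-trans L-small core-large)

        t-good : bad t Δ [] ≡ false
        t-good = cases (inside t) (bad t Δ []) refl refl
          where
          cases : ∀ i e → inside t ≡ i → bad t Δ [] ≡ e → bad t Δ [] ≡ false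
          cases _ false _ t-good = t-good
          cases false true t-outside _ = contradiction (<-≤-trans lt (≤-reflexive (trans
                (cong (λ e → 2 * N * (χ e * (x * y))) t-outside) (*-zeroʳ (2 * N))))) n≮0
          cases true true t-inside t-bad = contradiction lt (≤⇒≯ (begin
            2 * N * yield t                  ≤⟨ *-monoʳ-≤ (2 * N) yield≤ ⟩
            2 * N * (x * y)                  ≤⟨ *-monoʳ-≤ (2 * N) (*-mono-≤ x≤c (card≤n (core t))) ⟩
            2 * N * (c * n)                  ≡⟨ *-identityˡ _ ⟨
            1 * (2 * N * (c * n))            ≡⟨ cong (λ e → χ e * (2 * N * (c * n))) (∧-join t-inside t-bad) ⟨
            hit t * (2 * N * (c * n))        ≤⟨ m≤n+m _ _ ⟩
            lower t                          ∎))

        below : ∀ k s → bad t (suc k) s ≡ false → card (core t ∩ (λ v → bad t k (v ∷ s))) < L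
        below k s h = ≰⇒> (λ le → case-false (≤⇒≤ᵇ le))
          where
          case-false : ¬ T (bad t (suc k) s)
          case-false rewrite h = λ ()

        rich : ∀ k s → bad t k s ≡ false → g ≤ card (common G U s)
        rich zero s h = ≮⇒≥ (λ le → case-false (<⇒<ᵇ le))
          where
          case-false : ¬ T (bad t zero s)
          case-false rewrite h = λ ()
        -- Fewer than `L` of the at least `L` core vertices are harmful, so some `v ∷ s` is not bad
        -- at level `k`, and its common neighbourhood is contained in that of `s`.
        rich (suc k) s h
          with ∑-pigeonhole (λ v → χ (core t v ∧ bad t k (v ∷ s))) (λ v → χ (core t v)) V
                 (<-≤-trans (below k s h) L≤core)
        ... | v , v-good with core t v | bad t k (v ∷ s) in still-good
        ... | true | false =
          ≤-trans (rich k (v ∷ s) still-good) (card-mono (λ w → common-anti {v} {s} {w}))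
        ... | true | true = contradiction v-good (<-irrefl refl)
        ... | false | _ = contradiction v-good (<-irrefl refl)

        gate : Gate G Δ L g U
        gate = record
          { core  = core t
          ; bad   = bad t
          ; core⊆ = λ v h → proj₁ (∧-split {U v} h)
          ; start = t-good
          ; step  = λ k s h → <⇒≤ (below k s h)
          ; rich  = rich
          }

-- Partial embeddings

module Embedding {n m} (G : Graph n) (H : Graph m) where

  -- `φ` is total, with arbitrary values off `placed`. `free` is a set of its own, tied to the
  -- images only by disjointness (`φ-used`) and by the size bound `free-loss`.
  record State : Set where
    field
      placed    : Fin m → Bool
      φ         : Fin m → Fin n
      free      : Fin n → Bool
      φ-used    : ∀ x → placed x ≡ true → free (φ x) ≡ false
      φ-inj     : ∀ x y → placed x ≡ true → placed y ≡ true → φ x ≡ φ y → x ≡ y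
      φ-edge    : ∀ x y → placed x ≡ true → placed y ≡ true → adj H x y ≡ true →
                  adj G (φ x) (φ y) ≡ true
      free-loss : ∀ S → card S ≤ card (S ∩ free) + card placed

  open State

  card-remove : (S F : Fin n → Bool) → ∀ v →
    card (S ∩ F) ≤ card (S ∩ (λ w → F w ∧ not (w ≡ᵇ v))) + 1
  card-remove S F v = begin
    card (S ∩ F)
      ≤⟨ ∑-mono pointwise (allFin n) ⟩
    ∑ (allFin n) (λ w → χ ((S ∩ (λ w → F w ∧ not (w ≡ᵇ v))) w) + χ (w ≡ᵇ v))
      ≡⟨ ∑-+ _ _ (allFin n) ⟩
    card (S ∩ (λ w → F w ∧ not (w ≡ᵇ v))) + card (_≡ᵇ v)
      ≤⟨ +-monoʳ-≤ _ (card-singleton v) ⟩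
    card (S ∩ (λ w → F w ∧ not (w ≡ᵇ v))) + 1 ∎
    where
    open ≤-Reasoning
    pointwise : ∀ w → χ ((S ∩ F) w) ≤ χ (S w ∧ F w ∧ not (w ≡ᵇ v)) + χ (w ≡ᵇ v)
    pointwise w with S w | F w | w ≡ᵇ v
    ... | false | _ | _ = z≤n
    ... | true | false | _ = z≤n
    ... | true | true | true = s≤s z≤n
    ... | true | true | false = s≤s z≤n

  module _ (st : State) (z : Fin m) (v : Fin n) where

    placed⁺ : Fin m → Bool
    placed⁺ x = (x ≡ᵇ z) ∨ placed st x

    φ⁺ : Fin m → Fin n
    φ⁺ x = if x ≡ᵇ z then v else φ st x

    free⁺ : Fin n → Bool
    free⁺ w = free st w ∧ not (w ≡ᵇ v)

    placed⁺-new : placed⁺ z ≡ true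
    placed⁺-new with z Fin.≟ z
    ... | yes _ = refl
    ... | no z≢z = contradiction refl z≢z

    φ⁺-new : φ⁺ z ≡ v
    φ⁺-new with z Fin.≟ z
    ... | yes _ = refl
    ... | no z≢z = contradiction refl z≢z

    placed⁺-old : ∀ x → placed st x ≡ true → placed⁺ x ≡ true
    placed⁺-old x h rewrite h = ∨-zeroʳ (x ≡ᵇ z)

    placed⁺-only : ∀ x → placed⁺ x ≡ true → placed st x ≡ true ⊎ x ≡ z
    placed⁺-only x h with x Fin.≟ z
    ... | yes x≡z = inj₂ x≡z
    ... | no _ = inj₁ h

    card-placed⁺ : placed st z ≡ false → card (placed st) < card placed⁺
    card-placed⁺ z-new = ∑-mono-< (λ x → χ-mono (placed⁺-old x)) (∈-allFin z)
      (subst₂ (λ a b → χ a < χ b) (sym z-new) (sym placed⁺-new) ≤-refl)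

    module _ (z-new : placed st z ≡ false) where

      φ⁺-old : ∀ x → placed st x ≡ true → φ⁺ x ≡ φ st x
      φ⁺-old x h with x Fin.≟ z
      ... | yes refl = contradiction (trans (sym h) z-new) λ ()
      ... | no _ = refl

      extend : free st v ≡ true →
        (∀ x → placed st x ≡ true → adj H x z ≡ true → adj G (φ st x) v ≡ true) → State
      extend v-free adjacent = record
        { placed = placed⁺
        ; φ = φ⁺
        ; free = free⁺
        ; φ-used = used
        ; φ-inj = inj
        ; φ-edge = edge
        ; free-loss = loss
        }
        where
        used : ∀ x → placed⁺ x ≡ true → free⁺ (φ⁺ x) ≡ false
        used x h with placed⁺-only x h
        ... | inj₁ old rewrite φ⁺-old x old | φ-used st x old = refl
        ... | inj₂ refl rewrite φ⁺-new with v Fin.≟ v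
        ... | yes _ = ∧-zeroʳ (free st v)
        ... | no v≢v = contradiction refl v≢v

        not-used : ∀ x → placed st x ≡ true → φ st x ≢ v
        not-used x h refl = contradiction (trans (sym v-free) (φ-used st x h)) λ ()

        inj : ∀ x y → placed⁺ x ≡ true → placed⁺ y ≡ true → φ⁺ x ≡ φ⁺ y → x ≡ y
        inj x y hx hy e with placed⁺-only x hx | placed⁺-only y hy
        ... | inj₁ ox | inj₁ oy = φ-inj st x y ox oy (trans (sym (φ⁺-old x ox)) (trans e (φ⁺-old y oy)))
        ... | inj₁ ox | inj₂ refl =
          contradiction (trans (sym (φ⁺-old x ox)) (trans e φ⁺-new)) (not-used x ox)
        ... | inj₂ refl | inj₁ oy =
          contradiction (trans (sym (φ⁺-old y oy)) (trans (sym e) φ⁺-new)) (not-used y oy)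
        ... | inj₂ refl | inj₂ refl = refl

        edge : ∀ x y → placed⁺ x ≡ true → placed⁺ y ≡ true → adj H x y ≡ true →
               adj G (φ⁺ x) (φ⁺ y) ≡ true
        edge x y hx hy xy with placed⁺-only x hx | placed⁺-only y hy
        ... | inj₁ ox | inj₁ oy rewrite φ⁺-old x ox | φ⁺-old y oy = φ-edge st x y ox oy xy
        ... | inj₁ ox | inj₂ refl rewrite φ⁺-old x ox | φ⁺-new = adjacent x ox xy
        ... | inj₂ refl | inj₁ oy rewrite φ⁺-old y oy | φ⁺-new =
          trans (Graph.sym G v (φ st y)) (adjacent y oy (trans (Graph.sym H y z) xy))
        ... | inj₂ refl | inj₂ refl = contradiction (trans (sym xy) (irrefl H z)) λ ()

        loss : ∀ S → card S ≤ card (S ∩ free⁺) + card placed⁺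
        loss S = begin
          card S                                        ≤⟨ free-loss st S ⟩
          card (S ∩ free st) + card (placed st)         ≤⟨ +-monoˡ-≤ _ (card-remove S (free st) v) ⟩
          card (S ∩ free⁺) + 1 + card (placed st)       ≡⟨ +-assoc (card (S ∩ free⁺)) 1 _ ⟩
          card (S ∩ free⁺) + suc (card (placed st))     ≤⟨ +-monoʳ-≤ _ (card-placed⁺ z-new) ⟩
          card (S ∩ free⁺) + card placed⁺               ∎
          where open ≤-Reasoning

  -- Here `loss` is measured from the earlier state, whereas `free-loss` is measured from the start.
  -- A gate made at some stage is thus charged only for vertices placed afterwards.
  record Grows (st st′ : State) (zs : List (Fin m)) : Set where
    field
      keeps  : ∀ x → placed st x ≡ true → placed st′ x ≡ true
      same   : ∀ x → placed st x ≡ true → φ st′ x ≡ φ st x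
      only   : ∀ x → placed st′ x ≡ true → placed st x ≡ true ⊎ x ∈ zs
      covers : ∀ x → x ∈ zs → placed st′ x ≡ true
      loss   : ∀ S → card (S ∩ free st) ≤ card (S ∩ free st′) + length zs

  open Grows

  grows-[] : ∀ st → Grows st st []
  grows-[] st = record
    { keeps = λ _ h → h
    ; same = λ _ _ → refl
    ; only = λ _ → inj₁
    ; covers = λ _ ()
    ; loss = λ S → ≤-reflexive (sym (+-identityʳ _))
    }

  grows-skip : ∀ {st st′ z zs} → placed st z ≡ true → Grows st st′ zs → Grows st st′ (z ∷ zs)
  grows-skip {st} {st′} {z} {zs} z-old gr = record
    { keeps = keeps gr
    ; same = same gr
    ; only = λ x h → Sum.map₂ there (only gr x h)
    ; covers = λ { x (here refl) → keeps gr z z-old ; x (there x∈) → covers gr x x∈ }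
    ; loss = λ S → ≤-trans (loss gr S) (+-monoʳ-≤ _ (n≤1+n _))
    }

  grows-extend : ∀ st z v z-new v-free adjacent →
    Grows st (extend st z v z-new v-free adjacent) (z ∷ [])
  grows-extend st z v z-new v-free adjacent = record
    { keeps = placed⁺-old st z v
    ; same = φ⁺-old st z v z-new
    ; only = λ x h → Sum.map₂ here (placed⁺-only st z v x h)
    ; covers = λ { x (here refl) → placed⁺-new st z v }
    ; loss = λ S → card-remove S (free st) v
    }

  grows-trans : ∀ {st st′ st″ zs zs′} → Grows st st′ zs → Grows st′ st″ zs′ → Grows st st″ (zs ++ zs′)
  grows-trans {st} {st′} {st″} {zs} {zs′} gr gr′ = record
    { keeps = λ x h → keeps gr′ x (keeps gr x h)
    ; same = λ x h → trans (same gr′ x (keeps gr x h)) (same gr x h)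
    ; only = λ x h → only⁺ x (only gr′ x h)
    ; covers = λ x x∈ → covers⁺ x (∈-++⁻ zs x∈)
    ; loss = λ S → begin
        card (S ∩ free st)                              ≤⟨ loss gr S ⟩
        card (S ∩ free st′) + length zs                 ≤⟨ +-monoˡ-≤ (length zs) (loss gr′ S) ⟩
        card (S ∩ free st″) + length zs′ + length zs    ≡⟨ +-assoc _ (length zs′) (length zs) ⟩
        card (S ∩ free st″) + (length zs′ + length zs)  ≡⟨ cong (card (S ∩ free st″) +_)
                                                             (trans (+-comm (length zs′) _) (sym (length-++ zs))) ⟩
        card (S ∩ free st″) + length (zs ++ zs′)        ∎
    }
    where
    open ≤-Reasoning
    only⁺ : ∀ x → placed st′ x ≡ true ⊎ x ∈ zs′ → placed st x ≡ true ⊎ x ∈ zs ++ zs′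
    only⁺ x (inj₁ h) = Sum.map₂ ∈-++⁺ˡ (only gr x h)
    only⁺ x (inj₂ x∈) = inj₂ (∈-++⁺ʳ zs x∈)
    covers⁺ : ∀ x → x ∈ zs ⊎ x ∈ zs′ → placed st″ x ≡ true
    covers⁺ x (inj₁ x∈) = keeps gr′ x (covers gr x x∈)
    covers⁺ x (inj₂ x∈) = covers gr′ x x∈

  -- Greedy placement

  pending : State → Fin m → ℕ
  pending st y = card (adj H y ∩ (λ x → not (placed st x)))

  -- The certificate that `y` can still be embedded; each newly placed neighbour spends one level.
  -- The level may exceed the number of pending neighbours, so that every vertex can start from `[]`
  -- at level `Δ` whatever its degree.
  Tracked : (ℕ → List (Fin n) → Bool) → State → Fin m → Set
  Tracked bad st y = Σ[ s ∈ List (Fin n) ] Σ[ k ∈ ℕ ]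
    pending st y ≤ k × bad k s ≡ false ×
    (∀ x → placed st x ≡ true → adj H x y ≡ true → φ st x ∈ s)

  pending-grows : ∀ {st st′ zs} → Grows st st′ zs → ∀ y → pending st′ y ≤ pending st y
  pending-grows {st} {st′} gr y = card-mono λ x h →
    let (yx , new) = ∧-split {adj H y x} h in ∧-join yx (still x new)
    where
    still : ∀ x → not (placed st′ x) ≡ true → not (placed st x) ≡ true
    still x h with placed st x in e
    ... | false = refl
    ... | true rewrite keeps gr x e = h

  tracked-grows : ∀ {bad st st′ zs y} → Grows st st′ zs → (∀ x → x ∈ zs → adj H x y ≡ false) →
    Tracked bad st y → Tracked bad st′ y
  tracked-grows {st = st} {st′} {zs} {y} gr apart (s , k , p≤k , good , nbrs) =
    s , k , ≤-trans (pending-grows gr y) p≤k , good , nbrs′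
    where
    nbrs′ : ∀ x → placed st′ x ≡ true → adj H x y ≡ true → φ st′ x ∈ s
    nbrs′ x h xy with only gr x h
    ... | inj₁ old = subst (_∈ s) (sym (same gr x old)) (nbrs x old xy)
    ... | inj₂ x∈ = contradiction (trans (sym xy) (apart x x∈)) λ ()

  -- Each `y` has `g` candidates in `U₀`. Of these `ℓ` may have been lost beforehand and at most one
  -- is lost to each earlier entry of `ys`, so one is left. Since `ys` is independent, placing its
  -- members does not disturb the certificates of the rest.
  place-rich : ∀ {bad g} {U₀ : Fin n → Bool} →
    (∀ k s → bad k s ≡ false → g ≤ card (common G U₀ s)) →
    ∀ ys → (∀ x y → x ∈ ys → y ∈ ys → adj H x y ≡ false) →
    ∀ st → (∀ y → y ∈ ys → Tracked bad st y) →
    ∀ ℓ → (∀ S → card (S ∩ U₀) ≤ card (S ∩ free st) + ℓ) → ℓ + length ys ≤ g →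
    Σ[ st′ ∈ State ] Grows st st′ ys
  place-rich rich [] indep st tracked ℓ lost small = st , grows-[] st
  place-rich {bad} {g} {U₀} rich (y ∷ ys) indep st tracked ℓ lost small with placed st y in y-new
  -- This case absorbs repeated entries of the list.
  ... | true =
    let (st′ , gr) = place-rich rich ys (λ x x′ x∈ x′∈ → indep x x′ (there x∈) (there x′∈)) st
                       (λ x x∈ → tracked x (there x∈)) ℓ lost (≤-trans (+-monoʳ-≤ ℓ (n≤1+n _)) small)
    in st′ , grows-skip y-new gr
  ... | false with tracked y (here refl)
  ... | s , k , _ , good , nbrs = st″ , grows-trans gr₁ gr₂
    where
    open ≤-Reasoning
    nbhd : Fin n → Bool
    nbhd w = all (λ u → adj G u w) s
    room : 0 < card (nbhd ∩ free st)
    room = +-cancelʳ-≤ ℓ 1 _ (begin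
      1 + ℓ                            ≡⟨ +-comm 1 ℓ ⟩
      ℓ + 1                            ≤⟨ +-monoʳ-≤ ℓ (s≤s z≤n) ⟩
      ℓ + length (y ∷ ys)              ≤⟨ small ⟩
      g                                ≤⟨ rich k s good ⟩
      card (common G U₀ s)             ≤⟨ card-mono (λ w h → let (a , b) = ∧-split {U₀ w} h in ∧-join b a) ⟩
      card (nbhd ∩ U₀)                 ≤⟨ lost nbhd ⟩
      card (nbhd ∩ free st) + ℓ        ∎)
    v : Fin n
    v = proj₁ (card-pick (nbhd ∩ free st) room)
    v∈ : nbhd v ≡ true × free st v ≡ true
    v∈ = ∧-split {nbhd v} (proj₂ (card-pick (nbhd ∩ free st) room))
    st₁ : State
    st₁ = extend st y v y-new (proj₂ v∈)
            (λ x h xy → all-lookup (λ u → adj G u v) (proj₁ v∈) (nbrs x h xy))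
    gr₁ : Grows st st₁ (y ∷ [])
    gr₁ = grows-extend st y v y-new _ _
    rest : Σ[ st′ ∈ State ] Grows st₁ st′ ys
    rest = place-rich rich ys (λ x x′ x∈ x′∈ → indep x x′ (there x∈) (there x′∈)) st₁
      (λ x x∈ → tracked-grows gr₁ (λ { u (here refl) → indep u x (here refl) (there x∈) })
                  (tracked x (there x∈)))
      (ℓ + 1)
      (λ S → begin
        card (S ∩ U₀)                     ≤⟨ lost S ⟩
        card (S ∩ free st) + ℓ            ≤⟨ +-monoˡ-≤ ℓ (loss gr₁ S) ⟩
        card (S ∩ free st₁) + 1 + ℓ       ≡⟨ trans (+-assoc _ 1 ℓ) (cong (card (S ∩ free st₁) +_) (+-comm 1 ℓ)) ⟩
        card (S ∩ free st₁) + (ℓ + 1)     ∎)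
      (≤-trans (≤-reflexive (+-assoc ℓ 1 (length ys))) small)
    st″ : State
    st″ = proj₁ rest
    gr₂ : Grows st₁ st″ ys
    gr₂ = proj₂ rest

  module _ {Δ L} (H-deg : MaxDegreeAtMost H Δ) (A : Fin n → Bool)
           (bad : Fin m → ℕ → List (Fin n) → Bool)
           (step : ∀ y k s → bad y (suc k) s ≡ false → card (A ∩ (λ v → bad y k (v ∷ s))) ≤ L)
           (Active : Fin m → Set) where

    -- Each neighbour y of z forbids at most `L` vertices of `A`, so z has at most `Δ * L` forbidden
    -- ones, and the extra `length zs` pays for the vertices of `A` used on the way. No vertex of
    -- `zs` has a placed neighbour, so any free image respects the edges. `bad` depends on y because
    -- two layers, governed by different gates, are tracked at once.
    place-careful : ∀ zs → (∀ x z → x ∈ zs → z ∈ zs → adj H x z ≡ false) →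
      (∀ z y → z ∈ zs → adj H z y ≡ true → Active y) →
      ∀ st → (∀ x z → placed st x ≡ true → z ∈ zs → adj H x z ≡ false) →
      (∀ y → Active y → Tracked (bad y) st y) →
      Δ * L + length zs ≤ card (A ∩ free st) →
      Σ[ st′ ∈ State ] Grows st st′ zs × (∀ y → Active y → Tracked (bad y) st′ y)
    place-careful [] indep active st early tracked room = st , grows-[] st , tracked
    place-careful (z ∷ zs) indep active st early tracked room with placed st z in z-new
    ... | true =
      let (st′ , gr , tr) = place-careful zs (λ x x′ x∈ x′∈ → indep x x′ (there x∈) (there x′∈))
                              (λ x y x∈ → active x y (there x∈)) st
                              (λ x x′ h x′∈ → early x x′ h (there x′∈)) tracked
                              (≤-trans (+-monoʳ-≤ (Δ * L) (n≤1+n _)) room)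
      in st′ , grows-skip z-new gr , tr
    ... | false = st″ , grows-trans gr₁ gr₂ , tr″
      where
      open ≤-Reasoning
      AF : Fin n → Bool
      AF = A ∩ free st

      next : ∀ v → free st v ≡ true → State
      next v v-free = extend st z v z-new v-free
        (λ x h xz → contradiction (trans (sym xz) (early x z h (here refl))) λ ())

      grows-next : ∀ v v-free → Grows st (next v v-free) (z ∷ [])
      grows-next v v-free = grows-extend st z v z-new v-free _

      Obstacle : Fin m → Set
      Obstacle y = Σ[ Q ∈ (Fin n → Bool) ] card (AF ∩ Q) ≤ χ (adj H z y) * L ×
        (∀ v v-free → Q v ≡ false → Active y → Tracked (bad y) (next v v-free) y)

      obstacle : ∀ y → Obstacle y
      obstacle y with adj H z y in zy
      ... | false = (λ _ → false) , none , λ v v-free _ act →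
            tracked-grows (grows-next v v-free)
              (λ { x (here refl) → zy }) (tracked y act)
        where
        none : card (AF ∩ (λ _ → false)) ≤ 0
        none = begin
          card (AF ∩ (λ _ → false))   ≤⟨ ∑-mono (λ w → ≤-reflexive (cong χ (∧-zeroʳ (AF w)))) (allFin n) ⟩
          ∑ (allFin n) (λ _ → 0)      ≡⟨ trans (∑-allFin-const n 0) (*-zeroʳ n) ⟩
          0                           ∎
      ... | true with tracked y (active z y (here refl) zy)
      -- Level 0 cannot occur, since `z` itself is a pending neighbour of `y`.
      ... | s , zero , p≤0 , _ , _ = contradiction p≤0 (<⇒≱ z-pending)
        where
        z-pending : 0 < pending st y
        z-pending = begin-strict
          0                               ≡⟨ trans (∑-allFin-const m 0) (*-zeroʳ m) ⟨
          ∑ (allFin m) (λ _ → 0)          <⟨ ∑-mono-< (λ _ → z≤n) (∈-allFin z)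
            (≤-reflexive (sym (cong χ (∧-join {adj H y z} (trans (Graph.sym H y z) zy) (cong not z-new))))) ⟩
          pending st y                    ∎
      ... | s , suc k , p≤k , good , nbrs = (λ v → bad y k (v ∷ s)) , few , update
        where
        few : card (AF ∩ (λ v → bad y k (v ∷ s))) ≤ 1 * L
        few = begin
          card (AF ∩ (λ v → bad y k (v ∷ s)))
            ≤⟨ card-mono (λ w h → let (af , q) = ∧-split {AF w} h in
                 ∧-join (proj₁ (∧-split {A w} af)) q) ⟩
          card (A ∩ (λ v → bad y k (v ∷ s)))    ≤⟨ step y k s good ⟩
          L                                     ≡⟨ *-identityˡ L ⟨
          1 * L                                 ∎
        update : ∀ v v-free → bad y k (v ∷ s) ≡ false → Active y → Tracked (bad y) (next v v-free) y
        update v v-free ok _ = v ∷ s , k , ≤-pred (≤-trans fewer p≤k) , ok , nbrs′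
          where
          fewer : pending (next v v-free) y < pending st y
          fewer = ∑-mono-< (λ x → χ-mono (λ h → let (yx , new) = ∧-split {adj H y x} h in
                    ∧-join yx (unplaced x new))) (∈-allFin z) at-z
            where
            unplaced : ∀ x → not (placed⁺ st z v x) ≡ true → not (placed st x) ≡ true
            unplaced x h with placed st x in e
            ... | false = refl
            ... | true rewrite ∨-zeroʳ (x ≡ᵇ z) = h
            at-z : χ (adj H y z ∧ not (placed⁺ st z v z)) < χ (adj H y z ∧ not (placed st z))
            at-z rewrite placed⁺-new st z v | z-new | Graph.sym H y z | zy = ≤-refl
          nbrs′ : ∀ x → placed⁺ st z v x ≡ true → adj H x y ≡ true → φ⁺ st z v x ∈ v ∷ s
          nbrs′ x h xy with placed⁺-only st z v x h
          ... | inj₁ old = there (subst (_∈ s) (sym (φ⁺-old st z v z-new x old)) (nbrs x old xy))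
          ... | inj₂ refl = here (φ⁺-new st z v)

      Q : Fin m → Fin n → Bool
      Q y = proj₁ (obstacle y)

      few-obstacles : ∑ (allFin n) (λ v → ∑ (allFin m) (λ y → χ ((AF ∩ Q y) v))) < card AF
      few-obstacles = begin-strict
        ∑ (allFin n) (λ v → ∑ (allFin m) (λ y → χ ((AF ∩ Q y) v)))
          ≡⟨ ∑-swap _ (allFin n) (allFin m) ⟩
        ∑ (allFin m) (λ y → card (AF ∩ Q y))
          ≤⟨ ∑-mono (λ y → proj₁ (proj₂ (obstacle y))) (allFin m) ⟩
        ∑ (allFin m) (λ y → χ (adj H z y) * L)
          ≡⟨ ∑-*ʳ L _ (allFin m) ⟩
        degree H z * L
          ≤⟨ *-monoˡ-≤ L (H-deg z) ⟩
        Δ * L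
          <⟨ m<m+n (Δ * L) (s≤s z≤n) ⟩
        Δ * L + length (z ∷ zs)
          ≤⟨ room ⟩
        card AF ∎

      -- The number of obstacles at `v` is less than an indicator, hence 0, while the indicator is
      -- 1: `v` lies in `AF` and avoids every `Q y`.
      choice : Σ[ v ∈ Fin n ] ∑ (allFin m) (λ y → χ ((AF ∩ Q y) v)) < χ (AF v)
      choice = ∑-pigeonhole _ _ (allFin n) few-obstacles

      v : Fin n
      v = proj₁ choice
      AFv : AF v ≡ true
      AFv = χ-reflects (proj₂ choice)
      v-free : free st v ≡ true
      v-free = proj₂ (∧-split {A v} AFv)
      avoids : ∀ y → Q y v ≡ false
      avoids y = trans (sym (cong (_∧ Q y v) AFv)) (χ≡0 (∑≡0 (n<1⇒n≡0
        (<-≤-trans (proj₂ choice) (χ≤1 (AF v)))) (∈-allFin y)))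

      st₁ : State
      st₁ = next v v-free
      gr₁ : Grows st st₁ (z ∷ [])
      gr₁ = grows-next v v-free

      rest : Σ[ st′ ∈ State ] Grows st₁ st′ zs × (∀ y → Active y → Tracked (bad y) st′ y)
      rest = place-careful zs (λ x x′ x∈ x′∈ → indep x x′ (there x∈) (there x′∈))
        (λ x y x∈ → active x y (there x∈)) st₁ early₁
        (λ y → proj₂ (proj₂ (obstacle y)) v v-free (avoids y))
        (+-cancelʳ-≤ 1 _ _ (begin
          Δ * L + length zs + 1        ≡⟨ trans (+-assoc (Δ * L) _ 1) (cong (Δ * L +_) (+-comm _ 1)) ⟩
          Δ * L + length (z ∷ zs)      ≤⟨ room ⟩
          card AF                      ≤⟨ loss gr₁ A ⟩
          card (A ∩ free st₁) + 1      ∎))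
        where
        early₁ : ∀ x x′ → placed st₁ x ≡ true → x′ ∈ zs → adj H x x′ ≡ false
        early₁ x x′ h x′∈ with only gr₁ x h
        ... | inj₁ old = early x x′ old (there x′∈)
        ... | inj₂ (here refl) = indep x x′ (here refl) (there x′∈)
      st″ : State
      st″ = proj₁ rest
      gr₂ : Grows st₁ st″ zs
      gr₂ = proj₁ (proj₂ rest)
      tr″ : ∀ y → Active y → Tracked (bad y) st″ y
      tr″ = proj₂ (proj₂ rest)

-- Numerical estimates

module Scale (n d Δ b : ℕ) where

  -- D/N = (d/n)^(2Δ) is the density attached to a Δ-tuple; a core has at least Dn/(2N) vertices.
  -- The 8 in `g` comes from the at most four layers of at most 2b vertices placed between the
  -- recording of a gate's `U₀` and the end of the Y-layer that uses the gate.
  N D g : ℕ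
  N = (n * n) ^ Δ
  D = (d * d) ^ Δ
  g = 8 * b

  -- `L-lower` and `L-small` are the hypotheses of `gate-exists`. `loss-small` says that 4b lost
  -- vertices are at most half of the guaranteed core size Dn/(2N). `room-small` says that the
  -- guaranteed overlap D²n/(8N²) of two successive cores has room for the greedy placement of one
  -- X-layer.
  record Parameters : Set where
    field
      L          : ℕ
      positive   : 0 < D * n
      L-lower    : 2 * (n * n * g) < L * (d * d)
      L-small    : 2 * N * L ≤ D * n
      loss-small : 16 * b * N ≤ D * n
      room-small : 8 * (N * N) * (Δ * L + 2 * b) ≤ D * D * n

    open ≤-Reasoning

    after-loss : ∀ {x y} → D * n ≤ 2 * N * x → x ≤ y + 4 * b → D * n ≤ 4 * N * y
    after-loss {x} {y} large x≤ = +-cancelʳ-≤ (D * n) _ _ (begin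
      D * n + D * n                        ≤⟨ +-mono-≤ large large ⟩
      2 * N * x + 2 * N * x                ≡⟨ shape₁ N x ⟩
      4 * N * x                            ≤⟨ *-monoʳ-≤ (4 * N) x≤ ⟩
      4 * N * (y + 4 * b)                  ≡⟨ shape₂ N y b ⟩
      4 * N * y + 16 * b * N               ≤⟨ +-monoʳ-≤ (4 * N * y) loss-small ⟩
      4 * N * y + D * n                    ∎)
      where
      shape₁ : ∀ N x → 2 * N * x + 2 * N * x ≡ 4 * N * x
      shape₁ = solve-∀
      shape₂ : ∀ N y b → 4 * N * (y + 4 * b) ≡ 4 * N * y + 16 * b * N
      shape₂ = solve-∀

    room : ∀ {y a} → {{NonZero n}} → D * n ≤ 4 * N * y → D * y ≤ 2 * N * a → Δ * L + 2 * b ≤ a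
    room {y} {a} y-large a-large = *-cancelˡ-≤ (8 * (N * N)) {{m*n≢0 8 (N * N) {{_}} {{m*n≢0 N N {{N≢0}} {{N≢0}}}}}} (begin
      8 * (N * N) * (Δ * L + 2 * b)     ≤⟨ room-small ⟩
      D * D * n                         ≡⟨ *-assoc D D n ⟩
      D * (D * n)                       ≤⟨ *-monoʳ-≤ D y-large ⟩
      D * (4 * N * y)                   ≡⟨ x∙yz≡y∙xz D (4 * N) y ⟩
      4 * N * (D * y)                   ≤⟨ *-monoʳ-≤ (4 * N) a-large ⟩
      4 * N * (2 * N * a)               ≡⟨ shape N a ⟩
      8 * (N * N) * a                   ∎)
      where
      N≢0 : NonZero N
      N≢0 = m^n≢0 (n * n) Δ {{m*n≢0 n n}}
      shape : ∀ N a → 4 * N * (2 * N * a) ≡ 8 * (N * N) * a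
      shape = solve-∀

    nonempty : ∀ {y} → D * n ≤ 4 * N * y → 0 < y
    nonempty {zero} h = contradiction (≤-trans positive (≤-trans h (≤-reflexive (*-zeroʳ (4 * N))))) n≮0
    nonempty {suc y} h = s≤s z≤n

-- Choice of the parameters

module Constants (n d Δ b : ℕ) {{n≢0 : NonZero n}} {{Δ≢0 : NonZero Δ}} {{b≢0 : NonZero b}} (d≤n : d ≤ n)
  (bound : 256 * Δ * b * n ^ (6 * Δ) ≤ d ^ (6 * Δ + 1)) where

  open Scale n d Δ b
  open ≤-Reasoning

  ^6Δ : ∀ x → x ^ (6 * Δ) ≡ (x * x) ^ Δ * (x * x) ^ Δ * (x * x) ^ Δ
  ^6Δ x = trans (sym (^-*-assoc x 6 Δ)) (trans (cong (_^ Δ) (sixth x)) (trans (^-distribʳ-* Δ (x * x * (x * x)) (x * x))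
    (cong (_* (x * x) ^ Δ) (^-distribʳ-* Δ (x * x) (x * x)))))
    where
    sixth : ∀ x → x * (x * (x * (x * (x * (x * 1))))) ≡ x * x * (x * x) * (x * x)
    sixth = solve-∀

  instance
    N≢0 : NonZero N
    N≢0 = m^n≢0 (n * n) Δ {{m*n≢0 n n}}

    d≢0 : NonZero d
    d≢0 = ≢-nonZero λ d≡0 → contradiction (begin
      1                                ≤⟨ >-nonZero⁻¹ _ {{m*n≢0 (256 * Δ * b) (n ^ (6 * Δ)) {{m*n≢0 (256 * Δ) b {{m*n≢0 256 Δ}}}} {{m^n≢0 n (6 * Δ)}}}} ⟩
      256 * Δ * b * n ^ (6 * Δ)        ≤⟨ bound ⟩
      d ^ (6 * Δ + 1)                  ≡⟨ cong₂ _^_ d≡0 (+-comm (6 * Δ) 1) ⟩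
      0                                ∎) λ ()

    dd≢0 : NonZero (d * d)
    dd≢0 = m*n≢0 d d

    D≢0 : NonZero D
    D≢0 = m^n≢0 (d * d) Δ

    Dn≢0 : NonZero (D * n)
    Dn≢0 = m*n≢0 D n

  D≤N : D ≤ N
  D≤N = ^-monoˡ-≤ Δ (*-mono-≤ d≤n d≤n)

  -- This is (d/n)^(2Δ) ≤ d/n, by `d≤n` and Δ ≥ 1.
  Dn≤Nd : D * n ≤ N * d
  Dn≤Nd = go Δ
    where
    go : ∀ k → {{NonZero k}} → (d * d) ^ k * n ≤ (n * n) ^ k * d
    go (suc k) = begin
      d * d * (d * d) ^ k * n      ≡⟨ left d n ((d * d) ^ k) ⟩
      d * n * (d * (d * d) ^ k)    ≤⟨ *-monoʳ-≤ (d * n) (*-mono-≤ d≤n (^-monoˡ-≤ k (*-mono-≤ d≤n d≤n))) ⟩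
      d * n * (n * (n * n) ^ k)    ≡⟨ right d n ((n * n) ^ k) ⟩
      n * n * (n * n) ^ k * d      ∎
      where
      left : ∀ d n x → d * d * x * n ≡ d * n * (d * x)
      left = solve-∀
      right : ∀ d n x → d * n * (n * x) ≡ n * n * x * d
      right = solve-∀

  -- Through `^6Δ`, `bound` reads 256Δb ≤ (D/N)³d. One factor D/N is traded for d/n by `Dn≤Nd`, to
  -- pay for the n²/d² in `L`; the other two serve the two successive core sizes.
  main-bound : 256 * Δ * b * (N * N * n) ≤ D * D * (d * d)
  main-bound = *-cancelʳ-≤ _ _ N (begin
    256 * Δ * b * (N * N * n) * N     ≡⟨ shape₁ (256 * Δ * b) N n ⟩
    256 * Δ * b * (N * N * N) * n     ≡⟨ cong (λ e → 256 * Δ * b * e * n) (^6Δ n) ⟨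
    256 * Δ * b * n ^ (6 * Δ) * n     ≤⟨ *-monoˡ-≤ n bound ⟩
    d ^ (6 * Δ + 1) * n               ≡⟨ cong (_* n) (trans (^-distribˡ-+-* d (6 * Δ) 1) (cong₂ _*_ (^6Δ d) (*-identityʳ d))) ⟩
    D * D * D * d * n                 ≡⟨ shape₂ D d n ⟩
    D * D * d * (D * n)               ≤⟨ *-monoʳ-≤ (D * D * d) Dn≤Nd ⟩
    D * D * d * (N * d)               ≡⟨ shape₃ D d N ⟩
    D * D * (d * d) * N               ∎)
    where
    shape₁ : ∀ x N n → x * (N * N * n) * N ≡ x * (N * N * N) * n
    shape₁ = solve-∀
    shape₂ : ∀ D d n → D * D * D * d * n ≡ D * D * d * (D * n)
    shape₂ = solve-∀
    shape₃ : ∀ D d N → D * D * d * (N * d) ≡ D * D * (d * d) * N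
    shape₃ = solve-∀

  loss-small : 16 * b * N ≤ D * n
  loss-small = *-cancelʳ-≤ _ _ (N * n) {{m*n≢0 N n}} (begin
    16 * b * N * (N * n)           ≡⟨ shape₁ (16 * b) N n ⟩
    16 * b * (N * N * n)           ≤⟨ *-monoˡ-≤ (N * N * n) (*-monoˡ-≤ b (≤-trans (m≤m+n 16 240) (m≤m*n 256 Δ))) ⟩
    256 * Δ * b * (N * N * n)      ≤⟨ main-bound ⟩
    D * D * (d * d)                ≤⟨ *-mono-≤ (*-monoʳ-≤ D D≤N) (*-mono-≤ d≤n d≤n) ⟩
    D * N * (n * n)                ≡⟨ shape₂ D N n ⟩
    D * n * (N * n)                ∎)
    where
    shape₁ : ∀ x N n → x * N * (N * n) ≡ x * (N * N * n)
    shape₁ = solve-∀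
    shape₂ : ∀ D N n → D * N * (n * n) ≡ D * n * (N * n)
    shape₂ = solve-∀

  -- The least integer with `L * (d * d)` above 16bn², which is the quantity `2 * (n * n * g)` of
  -- `L-lower`.
  L : ℕ
  L = suc (16 * b * (n * n) / (d * d))

  L-lower : 2 * (n * n * g) < L * (d * d)
  L-lower = begin-strict
    2 * (n * n * g)              ≡⟨ shape n b ⟩
    X                            ≡⟨ m≡m%n+[m/n]*n X (d * d) ⟩
    X % (d * d) + X / (d * d) * (d * d)   <⟨ +-monoˡ-< _ (m%n<n X (d * d)) ⟩
    L * (d * d)                  ∎
    where
    X : ℕ
    X = 16 * b * (n * n)
    shape : ∀ n b → 2 * (n * n * (8 * b)) ≡ 16 * b * (n * n)
    shape = solve-∀

  L-upper : L * (d * d) ≤ 17 * (b * (n * n))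
  L-upper = begin
    d * d + 16 * b * (n * n) / (d * d) * (d * d)   ≤⟨ +-mono-≤ dd≤bnn (m/n*n≤m (16 * b * (n * n)) (d * d)) ⟩
    b * (n * n) + 16 * b * (n * n)                 ≡⟨ shape b (n * n) ⟩
    17 * (b * (n * n))                             ∎
    where
    dd≤bnn : d * d ≤ b * (n * n)
    dd≤bnn = ≤-trans (*-mono-≤ d≤n d≤n) (m≤n*m (n * n) b)
    shape : ∀ b x → b * x + 16 * b * x ≡ 17 * (b * x)
    shape = solve-∀

  room-small : 8 * (N * N) * (Δ * L + 2 * b) ≤ D * D * n
  room-small = *-cancelʳ-≤ _ _ (d * d) (begin
    8 * (N * N) * (Δ * L + 2 * b) * (d * d)
      ≡⟨ shape₁ (N * N) Δ L b (d * d) ⟩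
    8 * (N * N) * (Δ * (L * (d * d)) + 2 * (b * (d * d)))
      ≤⟨ *-monoʳ-≤ (8 * (N * N)) (+-mono-≤ (*-monoʳ-≤ Δ L-upper)
           (*-monoʳ-≤ 2 (≤-trans (*-monoʳ-≤ b (*-mono-≤ d≤n d≤n)) (m≤n*m (b * (n * n)) Δ)))) ⟩
    8 * (N * N) * (Δ * (17 * (b * (n * n))) + 2 * (Δ * (b * (n * n))))
      ≡⟨ shape₂ (N * N) Δ b n ⟩
    -- 152 = 8 · (17 + 2): the 17 is from `L-upper`, the 2 from the term `2 * b`.
    152 * (Δ * b * (N * N * n) * n)
      ≤⟨ *-monoˡ-≤ (Δ * b * (N * N * n) * n) (m≤m+n 152 104) ⟩
    256 * (Δ * b * (N * N * n) * n)
      ≡⟨ shape₃ Δ b (N * N * n) n ⟩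
    256 * Δ * b * (N * N * n) * n
      ≤⟨ *-monoˡ-≤ n main-bound ⟩
    D * D * (d * d) * n
      ≡⟨ shape₄ (D * D) (d * d) n ⟩
    D * D * n * (d * d) ∎)
    where
    shape₁ : ∀ x Δ L b y → 8 * x * (Δ * L + 2 * b) * y ≡ 8 * x * (Δ * (L * y) + 2 * (b * y))
    shape₁ = solve-∀
    shape₂ : ∀ x Δ b n → 8 * x * (Δ * (17 * (b * (n * n))) + 2 * (Δ * (b * (n * n)))) ≡ 152 * (Δ * b * (x * n) * n)
    shape₂ = solve-∀
    shape₃ : ∀ Δ b x n → 256 * (Δ * b * x * n) ≡ 256 * Δ * b * x * n
    shape₃ = solve-∀
    shape₄ : ∀ x y n → x * y * n ≡ x * n * y
    shape₄ = solve-∀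

  L-small : 2 * N * L ≤ D * n
  L-small = *-cancelʳ-≤ _ _ N (begin
    2 * N * L * N                        ≡⟨ shape₁ N L ⟩
    2 * (N * N * L)                      ≤⟨ *-mono-≤ (m≤m+n 2 6) (*-monoʳ-≤ (N * N) (≤-trans (m≤n*m L Δ) (m≤m+n (Δ * L) (2 * b)))) ⟩
    8 * (N * N * (Δ * L + 2 * b))        ≡⟨ *-assoc 8 (N * N) _ ⟨
    8 * (N * N) * (Δ * L + 2 * b)        ≤⟨ room-small ⟩
    D * D * n                            ≤⟨ *-monoˡ-≤ n (*-monoʳ-≤ D D≤N) ⟩
    D * N * n                            ≡⟨ shape₂ D N n ⟩
    D * n * N                            ∎)
    where
    shape₁ : ∀ N L → 2 * N * L * N ≡ 2 * (N * N * L)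
    shape₁ = solve-∀
    shape₂ : ∀ x y n → x * y * n ≡ x * n * y
    shape₂ = solve-∀

  parameters : Parameters
  parameters = record
    { L = L
    ; positive = >-nonZero⁻¹ (D * n)
    ; L-lower = L-lower
    ; L-small = L-small
    ; loss-small = loss-small
    ; room-small = room-small
    }

-- The staged embedding

module Windows {m} (σ : Permutation′ m) where

  label : Fin m → ℕ
  label x = toℕ (σ ⟨$⟩ʳ x)

  -- At most one vertex has shifted label `ℓ`, so windows assembled label by label have their length
  -- bounded at once.
  at : ℕ → ℕ → List (Fin m)
  at s ℓ with s ≤? ℓ | ℓ ∸ s <? m
  ... | yes _ | yes ℓ∸s<m = (σ ⟨$⟩ˡ fromℕ< ℓ∸s<m) ∷ []
  ... | _     | _         = []

  window : ℕ → ℕ → ℕ → List (Fin m)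
  window s lo zero = []
  window s lo (suc k) = at s lo ++ window s (suc lo) k

  length-at : ∀ s ℓ → length (at s ℓ) ≤ 1
  length-at s ℓ with s ≤? ℓ | ℓ ∸ s <? m
  ... | yes _ | yes _ = ≤-refl
  ... | yes _ | no _  = z≤n
  ... | no _  | _     = z≤n

  ∈-at⁻ : ∀ s ℓ {x} → x ∈ at s ℓ → label x + s ≡ ℓ
  ∈-at⁻ s ℓ x∈ with s ≤? ℓ | ℓ ∸ s <? m
  ∈-at⁻ s ℓ (here refl) | yes s≤ℓ | yes ℓ∸s<m =
    trans (cong (_+ s) (trans (cong toℕ (inverseʳ σ)) (toℕ-fromℕ< ℓ∸s<m))) (m∸n+n≡m s≤ℓ)

  ∈-at⁺ : ∀ s x → x ∈ at s (label x + s)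
  ∈-at⁺ s x with s ≤? label x + s | label x + s ∸ s <? m
  ... | yes _  | yes lt = here (trans (sym (inverseˡ σ))
                            (cong (σ ⟨$⟩ˡ_) (toℕ-injective (sym (trans (toℕ-fromℕ< lt) (m+n∸n≡m (label x) s))))))
  ... | yes _  | no ≮m  = contradiction (subst (_< m) (sym (m+n∸n≡m (label x) s)) (toℕ<n (σ ⟨$⟩ʳ x))) ≮m
  ... | no s≰  | _      = contradiction (m≤n+m s (label x)) s≰

  length-window : ∀ s lo k → length (window s lo k) ≤ k
  length-window s lo zero = z≤n
  length-window s lo (suc k) =
    ≤-trans (≤-reflexive (length-++ (at s lo))) (+-mono-≤ (length-at s lo) (length-window s (suc lo) k))

  ∈-window⁻ : ∀ s lo k {x} → x ∈ window s lo k → lo ≤ label x + s × label x + s < lo + k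
  ∈-window⁻ s lo (suc k) x∈ with ∈-++⁻ (at s lo) x∈
  ... | inj₁ x∈at rewrite ∈-at⁻ s lo x∈at = ≤-refl , m<m+n lo (s≤s z≤n)
  ... | inj₂ x∈rest with ∈-window⁻ s (suc lo) k x∈rest
  ... | lo< , <hi = <⇒≤ lo< , <-≤-trans <hi (≤-reflexive (sym (+-suc lo k)))

  ∈-window⁺ : ∀ s lo k {x} → lo ≤ label x + s → label x + s < lo + k → x ∈ window s lo k
  ∈-window⁺ s lo zero lo≤ <hi = contradiction (<-≤-trans <hi (≤-reflexive (+-identityʳ lo))) (≤⇒≯ lo≤)
  ∈-window⁺ s lo (suc k) {x} lo≤ <hi with lo ≟ label x + s
  ... | yes refl = ∈-++⁺ˡ (∈-at⁺ s x)
  ... | no lo≢ = ∈-++⁺ʳ (at s lo)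
        (∈-window⁺ s (suc lo) k (≤∧≢⇒< lo≤ lo≢) (<-≤-trans <hi (≤-reflexive (+-suc lo k))))

module Stages {n m} (G : Graph n) (H : Graph m) (d Δ b : ℕ)
  {{n≢0 : NonZero n}} {{Δ≢0 : NonZero Δ}} {{b≢0 : NonZero b}}
  (params : Scale.Parameters n d Δ b) (G-deg : ∀ v → m + d ≤ degree G v)
  (H-deg : MaxDegreeAtMost H Δ)
  (colour : Fin m → Bool) (proper : ∀ u v → adj H u v ≡ true → colour u ≢ colour v)
  (σ : Permutation′ m) (band : ∀ u v → adj H u v ≡ true → ∣ toℕ (σ ⟨$⟩ʳ u) - toℕ (σ ⟨$⟩ʳ v) ∣ ≤ b)
  where

  open Scale n d Δ b
  open Parameters params
  open Embedding G H
  open State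
  open Grows
  open Gate
  open Windows σ

  w : ℕ
  w = 2 * b

  shift : Bool → ℕ
  shift true = 0
  shift false = b

  -- Shifting one colour class by b makes every edge from true to false go forward by at most w.
  pos : Fin m → ℕ
  pos x = label x + shift (colour x)

  colour-false : ∀ {x y} → adj H x y ≡ true → colour x ≡ true → colour y ≡ false
  colour-false {x} {y} xy cx with colour y in cy
  ... | false = refl
  ... | true = contradiction (trans cx (sym cy)) (proper x y xy)

  colour-true : ∀ {x y} → adj H x y ≡ true → colour y ≡ false → colour x ≡ true
  colour-true {x} {y} xy cy with colour x in cx
  ... | true = refl
  ... | false = contradiction (trans cx (sym cy)) (proper x y xy)

  monochromatic : ∀ {x y} → colour x ≡ colour y → adj H x y ≡ false
  monochromatic {x} {y} e with adj H x y in xy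
  ... | false = refl
  ... | true = contradiction e (proper x y xy)

  pos-edge : ∀ {x y} → adj H x y ≡ true → colour x ≡ true → pos x ≤ pos y × pos y ≤ pos x + w
  pos-edge {x} {y} xy cx rewrite cx | colour-false xy cx = lower , upper
    where
    open ≤-Reasoning
    lower : label x + 0 ≤ label y + b
    lower = begin
      label x + 0                            ≡⟨ +-identityʳ (label x) ⟩
      label x                                ≤⟨ m≤n+∣m-n∣ (label x) (label y) ⟩
      label y + ∣ label x - label y ∣        ≤⟨ +-monoʳ-≤ (label y) (band x y xy) ⟩
      label y + b                            ∎
    upper : label y + b ≤ label x + 0 + w
    upper = begin
      label y + b                            ≤⟨ +-monoˡ-≤ b (m≤n+∣n-m∣ (label y) (label x)) ⟩
      label x + ∣ label x - label y ∣ + b    ≤⟨ +-monoˡ-≤ b (+-monoʳ-≤ (label x) (band x y xy)) ⟩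
      label x + b + b                        ≡⟨ shape (label x) b ⟩
      label x + 0 + w                        ∎
      where
      shape : ∀ x b → x + b + b ≡ x + 0 + 2 * b
      shape = solve-∀

  layer : Bool → ℕ → List (Fin m)
  layer κ M = filter (λ x → colour x Bool.≟ κ) (window (shift κ) M w)

  length-layer : ∀ κ M → length (layer κ M) ≤ w
  length-layer κ M = ≤-trans (length-filter (λ x → colour x Bool.≟ κ) (window (shift κ) M w)) (length-window (shift κ) M w)

  ∈-layer⁻ : ∀ {κ M x} → x ∈ layer κ M → colour x ≡ κ × M ≤ pos x × pos x < M + w
  ∈-layer⁻ {κ} {M} x∈ with ∈-filter⁻ (λ x → colour x Bool.≟ κ) {xs = window (shift κ) M w} x∈
  ... | x∈w , refl = refl , ∈-window⁻ _ M w x∈w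

  ∈-layer⁺ : ∀ {M x} → M ≤ pos x → pos x < M + w → x ∈ layer (colour x) M
  ∈-layer⁺ {M} {x} lo hi = ∈-filter⁺ (λ y → colour y Bool.≟ colour x) (∈-window⁺ _ M w lo hi) refl

  free-degree : ∀ st v → d ≤ card (adj G v ∩ free st)
  free-degree st v = +-cancelʳ-≤ m _ _ (begin
    d + m                                          ≡⟨ +-comm d m ⟩
    m + d                                          ≤⟨ G-deg v ⟩
    card (adj G v)                                 ≤⟨ free-loss st (adj G v) ⟩
    card (adj G v ∩ free st) + card (placed st)    ≤⟨ +-monoʳ-≤ _ (card≤n (placed st)) ⟩
    card (adj G v ∩ free st) + m                   ∎)
    where open ≤-Reasoning

  -- The situation just before Xᵢ is embedded, with M = i · w. After the first stage, `gate` is the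
  -- one for tᵢ chosen before Xᵢ₋₁ was placed, and `U₀` is the free set of that moment; the 4b in
  -- `lost` are the two layers placed since. `tracked` concerns Yᵢ, whose neighbours in Xᵢ₋₁ are
  -- already placed.
  record Stage (M : ℕ) : Set where
    field
      state   : State
      U₀      : Fin n → Bool
      gate    : Gate G Δ L g U₀
      large   : D * n ≤ 2 * N * card (core gate)
      lost    : ∀ S → card (S ∩ U₀) ≤ card (S ∩ free state) + 4 * b
      done    : ∀ x → pos x < M → placed state x ≡ true
      early   : ∀ x → placed state x ≡ true → pos x < M
      tracked : ∀ y → colour y ≡ false → M ≤ pos y → pos y < M + w → Tracked (bad gate) state y

  untouched : ∀ {U} (γ : Gate G Δ L g U) st y →
    (∀ x → placed st x ≡ true → adj H x y ≡ false) → Tracked (bad γ) st y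
  untouched γ st y apart = [] , Δ , few , start γ ,
    λ x h xy → contradiction (trans (sym xy) (apart x h)) λ ()
    where
    few : pending st y ≤ Δ
    few = ≤-trans (card-mono {S′ = adj H y} (λ x h → proj₁ (∧-split {adj H y x} h))) (H-deg y)

  next-stage : ∀ {M} → Stage M → Stage (M + w)
  next-stage {M} S = record
    { state = st₂
    ; U₀ = free st
    ; gate = γ′
    ; large = proj₁ (proj₂ γ′-exists)
    ; lost = λ S → ≤-trans (loss gr₁₂ S) (+-monoʳ-≤ _ (≤-trans (≤-reflexive (length-++ xs))
               (≤-trans (+-mono-≤ (length-layer true M) (length-layer false M)) (≤-reflexive (shape b)))))
    ; done = done′
    ; early = early′
    ; tracked = λ y cy lo _ → tracked-grows gr₂
        (λ x x∈ → monochromatic (trans (proj₁ (∈-layer⁻ x∈)) (sym cy)))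
        (subst (λ B → Tracked B st₁ y) (target-far y lo) (tracked₁ y (cy , ≤-trans (m≤m+n M w) lo)))
    }
    where
    open Stage S renaming (state to st; gate to γ)
    open ≤-Reasoning

    C : Fin n → Bool
    C = core γ ∩ free st

    C⊆free : ∀ v → C v ≡ true → free st v ≡ true
    C⊆free v h = proj₂ (∧-split {core γ v} h)

    C-large : D * n ≤ 4 * N * card C
    C-large = after-loss large (begin
      card (core γ)            ≤⟨ card-mono (λ v h → ∧-join h (core⊆ γ v h)) ⟩
      card (core γ ∩ U₀)       ≤⟨ lost (core γ) ⟩
      card C + 4 * b           ∎)

    instance
      C≢0 : NonZero (card C)
      C≢0 = >-nonZero (nonempty C-large)

    abstract
      γ′-exists : Σ[ γ′ ∈ Gate G Δ L g (free st) ] D * n ≤ 2 * N * card (core γ′) ×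
        D * card C ≤ 2 * N * card (core γ′ ∩ C)
      γ′-exists = GateExistence.gate-exists G Δ L g (free st) C C⊆free d (free-degree st) L-lower L-small

    γ′ : Gate G Δ L g (free st)
    γ′ = proj₁ γ′-exists

    A : Fin n → Bool
    A = core γ′ ∩ C

    -- The neighbours of Xᵢ lie in Yᵢ, which the old gate governs, and in Yᵢ₊₁, which the new one
    -- will govern.
    target : Fin m → ℕ → List (Fin n) → Bool
    target y = if ⌊ pos y <? M + w ⌋ then bad γ else bad γ′

    target-near : ∀ y → pos y < M + w → target y ≡ bad γ
    target-near y lt with pos y <? M + w
    ... | yes _ = refl
    ... | no ≮ = contradiction lt ≮

    target-far : ∀ y → M + w ≤ pos y → target y ≡ bad γ′
    target-far y le with pos y <? M + w
    ... | yes lt = contradiction lt (≤⇒≯ le)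
    ... | no _ = refl

    target-step : ∀ y k s → target y (suc k) s ≡ false → card (A ∩ (λ v → target y k (v ∷ s))) ≤ L
    target-step y k s good with pos y <? M + w
    ... | yes _ = ≤-trans (card-mono (λ v h →
            let (in-A , is-bad) = ∧-split {A v} h
                (_ , in-C) = ∧-split {core γ′ v} in-A
            in ∧-join (proj₁ (∧-split {core γ v} in-C)) is-bad)) (step γ k s good)
    ... | no _ = ≤-trans (card-mono (λ v h →
            let (in-A , is-bad) = ∧-split {A v} h
            in ∧-join (proj₁ (∧-split {core γ′ v} in-A)) is-bad)) (step γ′ k s good)

    Active : Fin m → Set
    Active y = colour y ≡ false × M ≤ pos y

    tracked₀ : ∀ y → Active y → Tracked (target y) st y
    tracked₀ y (cy , lo) with pos y <? M + w
    ... | yes hi = tracked y cy lo hi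
    -- Placed vertices lie before `M` and an edge advances by at most `w`, so a vertex at `M + w` or
    -- beyond has no placed neighbour and can start afresh with the new gate.
    ... | no ≮ = untouched γ′ st y apart
      where
      apart : ∀ x → placed st x ≡ true → adj H x y ≡ false
      apart x h with adj H x y in xy
      ... | false = refl
      ... | true = contradiction (≤-<-trans (proj₂ (pos-edge xy (colour-true xy cy)))
                                            (+-monoˡ-< w (early x h))) ≮

    xs ys : List (Fin m)
    xs = layer true M
    ys = layer false M

    active : ∀ z y → z ∈ xs → adj H z y ≡ true → Active y
    active z y z∈ zy with ∈-layer⁻ z∈
    ... | cz , lo , _ = colour-false zy cz , ≤-trans lo (proj₁ (pos-edge zy cz))

    first : ∀ x z → placed st x ≡ true → z ∈ xs → adj H x z ≡ false
    first x z h z∈ with adj H x z in xz | ∈-layer⁻ z∈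
    ... | false | _ = refl
    ... | true | cz , lo , _ = contradiction
      (≤-<-trans (≤-trans lo (proj₁ (pos-edge (trans (Graph.sym H z x) xz) cz))) (early x h)) (<-irrefl refl)

    abstract
      phase₁ : Σ[ st′ ∈ State ] Grows st st′ xs × (∀ y → Active y → Tracked (target y) st′ y)
      phase₁ = place-careful H-deg A target target-step Active xs
        (λ x z x∈ z∈ → monochromatic (trans (proj₁ (∈-layer⁻ x∈)) (sym (proj₁ (∈-layer⁻ z∈)))))
        active st first tracked₀ (begin
          Δ * L + length xs      ≤⟨ +-monoʳ-≤ (Δ * L) (length-layer true M) ⟩
          Δ * L + 2 * b          ≤⟨ room C-large (proj₂ (proj₂ γ′-exists)) ⟩
          card A                 ≤⟨ card-mono (λ v h → ∧-join h (C⊆free v (proj₂ (∧-split {core γ′ v} h)))) ⟩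
          card (A ∩ free st)     ∎)

    st₁ : State
    st₁ = proj₁ phase₁
    gr₁ : Grows st st₁ xs
    gr₁ = proj₁ (proj₂ phase₁)
    tracked₁ : ∀ y → Active y → Tracked (target y) st₁ y
    tracked₁ = proj₂ (proj₂ phase₁)

    abstract
      phase₂ : Σ[ st′ ∈ State ] Grows st₁ st′ ys
      phase₂ = place-rich (rich γ) ys
        (λ x z x∈ z∈ → monochromatic (trans (proj₁ (∈-layer⁻ x∈)) (sym (proj₁ (∈-layer⁻ z∈)))))
        st₁
        (λ y y∈ → let (cy , lo , hi) = ∈-layer⁻ y∈ in
          subst (λ B → Tracked B st₁ y) (target-near y hi) (tracked₁ y (cy , lo)))
        -- Lost since `U₀`: 4b before this stage and `w` to `xs`. With the 2b places for `ys` this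
        -- is exactly `g`.
        (w + 4 * b)
        (λ S → begin
          card (S ∩ U₀)                                ≤⟨ lost S ⟩
          card (S ∩ free st) + 4 * b                   ≤⟨ +-monoˡ-≤ (4 * b) (loss gr₁ S) ⟩
          card (S ∩ free st₁) + length xs + 4 * b      ≤⟨ +-monoˡ-≤ (4 * b) (+-monoʳ-≤ (card (S ∩ free st₁)) (length-layer true M)) ⟩
          card (S ∩ free st₁) + w + 4 * b              ≡⟨ +-assoc (card (S ∩ free st₁)) w (4 * b) ⟩
          card (S ∩ free st₁) + (w + 4 * b)            ∎)
        (≤-trans (+-monoʳ-≤ (w + 4 * b) (length-layer false M)) (≤-reflexive (eight b)))
        where
        eight : ∀ b → 2 * b + 4 * b + 2 * b ≡ 8 * b
        eight = solve-∀

    st₂ : State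
    st₂ = proj₁ phase₂
    gr₂ : Grows st₁ st₂ ys
    gr₂ = proj₂ phase₂
    gr₁₂ : Grows st st₂ (xs ++ ys)
    gr₁₂ = grows-trans gr₁ gr₂

    shape : ∀ b → 2 * b + 2 * b ≡ 4 * b
    shape = solve-∀

    done′ : ∀ x → pos x < M + w → placed st₂ x ≡ true
    done′ x hi with pos x <? M
    ... | yes lt = keeps gr₁₂ x (done x lt)
    ... | no ≮ = covers gr₁₂ x (in-layer (colour x) (∈-layer⁺ (≮⇒≥ ≮) hi))
      where
      in-layer : ∀ κ → x ∈ layer κ M → x ∈ xs ++ ys
      in-layer true x∈ = ∈-++⁺ˡ x∈
      in-layer false x∈ = ∈-++⁺ʳ xs x∈

    early′ : ∀ x → placed st₂ x ≡ true → pos x < M + w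
    early′ x h with only gr₁₂ x h
    ... | inj₁ old = <-≤-trans (early x old) (m≤m+n M w)
    ... | inj₂ x∈ with ∈-++⁻ xs x∈
    ... | inj₁ x∈xs = proj₂ (proj₂ (∈-layer⁻ x∈xs))
    ... | inj₂ x∈ys = proj₂ (proj₂ (∈-layer⁻ x∈ys))

  empty-state : State
  empty-state = record
    { placed = λ _ → false
    ; φ = λ _ → fromℕ< (>-nonZero⁻¹ n)
    ; free = λ _ → true
    ; φ-used = λ _ ()
    ; φ-inj = λ _ _ ()
    ; φ-edge = λ _ _ ()
    ; free-loss = λ S → ≤-trans (card-mono {S = S} (λ v h → ∧-join h refl)) (m≤m+n _ _)
    }

  -- There is no earlier core to meet, so `C` is the whole vertex set.
  first-stage : Stage 0
  first-stage = record
    { state = empty-state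
    ; U₀ = free empty-state
    ; gate = proj₁ γ-exists
    ; large = proj₁ (proj₂ γ-exists)
    ; lost = λ S → m≤m+n _ _
    ; done = λ _ ()
    ; early = λ _ ()
    ; tracked = λ y _ _ _ → untouched (proj₁ γ-exists) empty-state y (λ _ ())
    }
    where
    instance
      all≢0 : NonZero (card {n} (λ _ → true))
      all≢0 = subst NonZero (sym (trans (∑-allFin-const n 1) (*-identityʳ n))) n≢0
    abstract
      γ-exists : Σ[ γ ∈ Gate G Δ L g (λ _ → true) ] D * n ≤ 2 * N * card (core γ) ×
        D * card {n} (λ _ → true) ≤ 2 * N * card (core γ ∩ (λ _ → true))
      γ-exists = GateExistence.gate-exists G Δ L g (λ _ → true) (λ _ → true) (λ _ h → h) d
        (free-degree empty-state) L-lower L-small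

  stage : ∀ i → Stage (i * w)
  stage zero = first-stage
  stage (suc i) = subst Stage (+-comm (i * w) w) (next-stage (stage i))

  embeds : SubgraphOf H G
  embeds = φ st , (λ {x} {y} → φ-inj st x y (all-placed x) (all-placed y)) ,
           λ x y → φ-edge st x y (all-placed x) (all-placed y)
    where
    -- Every position is below m + b and w ≥ 1, so m + b stages are enough.
    last : Stage ((m + b) * w)
    last = stage (m + b)
    st : State
    st = Stage.state last
    shift≤b : ∀ κ → shift κ ≤ b
    shift≤b true = z≤n
    shift≤b false = ≤-refl
    all-placed : ∀ x → placed st x ≡ true
    all-placed x = Stage.done last x (begin-strict
      label x + shift (colour x)    <⟨ +-mono-<-≤ (toℕ<n (σ ⟨$⟩ʳ x)) (shift≤b (colour x)) ⟩
      m + b                         ≤⟨ m≤m*n (m + b) w {{m*n≢0 2 b}} ⟩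
      (m + b) * w                   ∎)
      where open ≤-Reasoning

-- Passage from ℚ to ℕ

toℚᵘ-ℕ→ℚ : ∀ k → ℚ.toℚᵘ (ℕ→ℚ k) ℚᵘ.≃ mkℚᵘ (ℤ.+ k) 0
toℚᵘ-ℕ→ℚ k = ℚ.toℚᵘ-fromℚᵘ (mkℚᵘ (ℤ.+ k) 0)

ℕ→ℚ-+ : ∀ j k → ℕ→ℚ (j + k) ≡ ℕ→ℚ j ℚ.+ ℕ→ℚ k
ℕ→ℚ-+ j k = ℚ.toℚᵘ-injective (begin-equality
  ℚ.toℚᵘ (ℕ→ℚ (j + k))                          ≃⟨ toℚᵘ-ℕ→ℚ (j + k) ⟩
  mkℚᵘ (ℤ.+ (j + k)) 0                            ≃⟨ *≡* (cong (ℤ._* (ℤ.+ 1)) (trans (ℤ.pos-+ j k)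
                                                     (sym (cong₂ ℤ._+_ (ℤ.*-identityʳ (ℤ.+ j)) (ℤ.*-identityʳ (ℤ.+ k)))))) ⟩
  mkℚᵘ (ℤ.+ j) 0 ℚᵘ.+ mkℚᵘ (ℤ.+ k) 0                ≃⟨ ℚᵘ.+-cong (toℚᵘ-ℕ→ℚ j) (toℚᵘ-ℕ→ℚ k) ⟨
  ℚ.toℚᵘ (ℕ→ℚ j) ℚᵘ.+ ℚ.toℚᵘ (ℕ→ℚ k)            ≃⟨ ℚ.toℚᵘ-homo-+ (ℕ→ℚ j) (ℕ→ℚ k) ⟨
  ℚ.toℚᵘ (ℕ→ℚ j ℚ.+ ℕ→ℚ k)                      ∎)
  where open ℚᵘ.≤-Reasoning

ℕ→ℚ-* : ∀ j k → ℕ→ℚ (j * k) ≡ ℕ→ℚ j ℚ.* ℕ→ℚ k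
ℕ→ℚ-* j k = ℚ.toℚᵘ-injective (begin-equality
  ℚ.toℚᵘ (ℕ→ℚ (j * k))                          ≃⟨ toℚᵘ-ℕ→ℚ (j * k) ⟩
  mkℚᵘ (ℤ.+ (j * k)) 0                            ≃⟨ *≡* (cong (ℤ._* (ℤ.+ 1)) (ℤ.pos-* j k)) ⟩
  mkℚᵘ (ℤ.+ j) 0 ℚᵘ.* mkℚᵘ (ℤ.+ k) 0                ≃⟨ ℚᵘ.*-cong (toℚᵘ-ℕ→ℚ j) (toℚᵘ-ℕ→ℚ k) ⟨
  ℚ.toℚᵘ (ℕ→ℚ j) ℚᵘ.* ℚ.toℚᵘ (ℕ→ℚ k)            ≃⟨ ℚ.toℚᵘ-homo-* (ℕ→ℚ j) (ℕ→ℚ k) ⟨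
  ℚ.toℚᵘ (ℕ→ℚ j ℚ.* ℕ→ℚ k)                      ∎)
  where open ℚᵘ.≤-Reasoning

ℕ→ℚ-^ : ∀ j k → ℕ→ℚ (j ^ k) ≡ ℕ→ℚ j ^ℚ k
ℕ→ℚ-^ j zero = refl
ℕ→ℚ-^ j (suc k) = trans (ℕ→ℚ-* j (j ^ k)) (cong (ℕ→ℚ j ℚ.*_) (ℕ→ℚ-^ j k))

ℕ→ℚ-cancel-≤ : ∀ {j k} → ℕ→ℚ j ℚ.≤ ℕ→ℚ k → j ≤ k
ℕ→ℚ-cancel-≤ {j} {k} h
  with ℚᵘ.≤-trans (ℚᵘ.≤-reflexive (ℚᵘ.≃-sym (toℚᵘ-ℕ→ℚ j)))
         (ℚᵘ.≤-trans (ℚ.toℚᵘ-mono-≤ h) (ℚᵘ.≤-reflexive (toℚᵘ-ℕ→ℚ k)))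
... | *≤* le = ℤ.drop‿+≤+ (subst₂ ℤ._≤_ (ℤ.*-identityʳ (ℤ.+ j)) (ℤ.*-identityʳ (ℤ.+ k)) le)

ℕ→ℚ-nonNeg : ∀ k → ℚ.NonNegative (ℕ→ℚ k)
ℕ→ℚ-nonNeg k = ℚ.normalize-nonNeg k 1

ℕ→ℚ-inverse : ∀ k .{{_ : NonZero k}} → ℕ→ℚ k ℚ.* (ℤ.+ 1 ℚ./ k) ≡ 1ℚ
ℕ→ℚ-inverse (suc k) = ℚ.toℚᵘ-injective (begin-equality
  ℚ.toℚᵘ (ℕ→ℚ (suc k) ℚ.* (ℤ.+ 1 ℚ./ suc k))              ≃⟨ ℚ.toℚᵘ-homo-* (ℕ→ℚ (suc k)) (ℤ.+ 1 ℚ./ suc k) ⟩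
  ℚ.toℚᵘ (ℕ→ℚ (suc k)) ℚᵘ.* ℚ.toℚᵘ (ℤ.+ 1 ℚ./ suc k)      ≃⟨ ℚᵘ.*-cong (toℚᵘ-ℕ→ℚ (suc k)) (ℚ.toℚᵘ-fromℚᵘ (mkℚᵘ (ℤ.+ 1) k)) ⟩
  mkℚᵘ (ℤ.+ suc k) 0 ℚᵘ.* mkℚᵘ (ℤ.+ 1) k                    ≃⟨ *≡* (cong ℤ.+_ (lemma k)) ⟩
  ℚ.toℚᵘ 1ℚ                                             ∎)
  where
  open ℚᵘ.≤-Reasoning
  lemma : ∀ k → suc k * 1 * 1 ≡ 1 * (1 * suc k)
  lemma = solve-∀

^ℚ-distrib-* : ∀ k x y → (x ℚ.* y) ^ℚ k ≡ x ^ℚ k ℚ.* y ^ℚ k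
^ℚ-distrib-* zero x y = refl
^ℚ-distrib-* (suc k) x y = trans (cong (x ℚ.* y ℚ.*_) (^ℚ-distrib-* k x y))
  (solve 4 (λ a b c d → a :* b :* (c :* d) := a :* c :* (b :* d)) refl x y (x ^ℚ k) (y ^ℚ k))
  where open +-*-Solver

^ℚ-nonNeg : ∀ k x → .{{ℚ.NonNegative x}} → ℚ.NonNegative (x ^ℚ k)
^ℚ-nonNeg zero x = _
^ℚ-nonNeg (suc k) x = ℚ.nonNeg*nonNeg⇒nonNeg x (x ^ℚ k) {{^ℚ-nonNeg k x}}

^ℚ-monoˡ-≤ : ∀ k {x y} → .{{ℚ.NonNegative x}} → .{{ℚ.NonNegative y}} → x ℚ.≤ y → x ^ℚ k ℚ.≤ y ^ℚ k
^ℚ-monoˡ-≤ zero x≤y = ℚ.≤-refl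
^ℚ-monoˡ-≤ (suc k) {x} {y} x≤y = ℚ.≤-trans
  (ℚ.*-monoʳ-≤-nonNeg (x ^ℚ k) {{^ℚ-nonNeg k x}} x≤y)
  (ℚ.*-monoˡ-≤-nonNeg y (^ℚ-monoˡ-≤ k x≤y))

-- Multiplication by c · Δ · n^e cancels both reciprocals and completes α^(e+1) · n to (αn)^(e+1),
-- which is at most d^(e+1).
clear-denominators : ∀ α → .{{Positive α}} → ∀ c .{{_ : NonZero c}} Δ .{{_ : NonZero Δ}} n d b e →
  α ℚ.* ℕ→ℚ n ℚ.≤ ℕ→ℚ d →
  ℕ→ℚ b ℚ.≤ (ℤ.+ 1 ℚ./ c) ℚ.* (ℤ.+ 1 ℚ./ Δ) ℚ.* (α ^ℚ (e + 1)) ℚ.* ℕ→ℚ n →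
  c * Δ * b * n ^ e ≤ d ^ (e + 1)
clear-denominators α c Δ n d b e αn≤d b≤ = ℕ→ℚ-cancel-≤ (begin
  ℕ→ℚ (c * Δ * b * n ^ e)
    ≡⟨ trans (ℕ→ℚ-* (c * Δ * b) (n ^ e)) (cong (ℚ._* ℕ→ℚ (n ^ e)) (ℕ→ℚ-* (c * Δ) b)) ⟩
  ℕ→ℚ (c * Δ) ℚ.* ℕ→ℚ b ℚ.* ℕ→ℚ (n ^ e)
    ≤⟨ ℚ.*-monoʳ-≤-nonNeg (ℕ→ℚ (n ^ e)) {{ℕ→ℚ-nonNeg (n ^ e)}}
         (ℚ.*-monoˡ-≤-nonNeg (ℕ→ℚ (c * Δ)) {{ℕ→ℚ-nonNeg (c * Δ)}} b≤) ⟩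
  ℕ→ℚ (c * Δ) ℚ.* (r ℚ.* s ℚ.* p ℚ.* ℕ→ℚ n) ℚ.* ℕ→ℚ (n ^ e)
    ≡⟨ cong (λ x → x ℚ.* (r ℚ.* s ℚ.* p ℚ.* ℕ→ℚ n) ℚ.* ℕ→ℚ (n ^ e)) (ℕ→ℚ-* c Δ) ⟩
  ℕ→ℚ c ℚ.* ℕ→ℚ Δ ℚ.* (r ℚ.* s ℚ.* p ℚ.* ℕ→ℚ n) ℚ.* ℕ→ℚ (n ^ e)
    ≡⟨ regroup (ℕ→ℚ c) (ℕ→ℚ Δ) r s p (ℕ→ℚ n) (ℕ→ℚ (n ^ e)) ⟩
  (ℕ→ℚ c ℚ.* r) ℚ.* (ℕ→ℚ Δ ℚ.* s) ℚ.* (p ℚ.* (ℕ→ℚ n ℚ.* ℕ→ℚ (n ^ e)))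
    ≡⟨ cong₂ (λ x y → x ℚ.* y ℚ.* (p ℚ.* (ℕ→ℚ n ℚ.* ℕ→ℚ (n ^ e)))) (ℕ→ℚ-inverse c) (ℕ→ℚ-inverse Δ) ⟩
  1ℚ ℚ.* 1ℚ ℚ.* (p ℚ.* (ℕ→ℚ n ℚ.* ℕ→ℚ (n ^ e)))
    ≡⟨ trans (cong (ℚ._* (p ℚ.* (ℕ→ℚ n ℚ.* ℕ→ℚ (n ^ e)))) (ℚ.*-identityˡ 1ℚ)) (ℚ.*-identityˡ _) ⟩
  p ℚ.* (ℕ→ℚ n ℚ.* ℕ→ℚ (n ^ e))
    ≡⟨ cong (p ℚ.*_) (trans (sym (ℕ→ℚ-* n (n ^ e))) (trans (cong (λ j → ℕ→ℚ (n ^ j)) (+-comm 1 e)) (ℕ→ℚ-^ n (e + 1)))) ⟩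
  p ℚ.* ℕ→ℚ n ^ℚ (e + 1)
    ≡⟨ ^ℚ-distrib-* (e + 1) α (ℕ→ℚ n) ⟨
  (α ℚ.* ℕ→ℚ n) ^ℚ (e + 1)
    ≤⟨ ^ℚ-monoˡ-≤ (e + 1) {{ℚ.nonNeg*nonNeg⇒nonNeg α {{ℚ.pos⇒nonNeg α}} (ℕ→ℚ n) {{ℕ→ℚ-nonNeg n}}}}
         {{ℕ→ℚ-nonNeg d}} αn≤d ⟩
  ℕ→ℚ d ^ℚ (e + 1)
    ≡⟨ ℕ→ℚ-^ d (e + 1) ⟨
  ℕ→ℚ (d ^ (e + 1)) ∎)
  where
  open ℚ.≤-Reasoning
  r s p : ℚ
  r = ℤ.+ 1 ℚ./ c
  s = ℤ.+ 1 ℚ./ Δ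
  p = α ^ℚ (e + 1)
  regroup : ∀ x y r s p z w →
    x ℚ.* y ℚ.* (r ℚ.* s ℚ.* p ℚ.* z) ℚ.* w ≡ (x ℚ.* r) ℚ.* (y ℚ.* s) ℚ.* (p ℚ.* (z ℚ.* w))
  regroup = solve 7 (λ x y r s p z w →
    x :* y :* (r :* s :* p :* z) :* w := (x :* r) :* (y :* s) :* (p :* (z :* w))) refl
    where open +-*-Solver

module _ {n} (G : Graph n) (δ α : ℚ) .{{_ : Positive α}} (m : ℕ)
         (G-deg : MinDegreeAtLeast G ((δ ℚ.+ α) ℚ.* ℕ→ℚ n)) (m≤δn : ℕ→ℚ m ℚ.≤ δ ℚ.* ℕ→ℚ n) where

  degree-surplus : ∀ v → ℕ→ℚ m ℚ.+ α ℚ.* ℕ→ℚ n ℚ.≤ ℕ→ℚ (degree G v)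
  degree-surplus v = begin
    ℕ→ℚ m ℚ.+ α ℚ.* ℕ→ℚ n              ≤⟨ ℚ.+-monoˡ-≤ (α ℚ.* ℕ→ℚ n) m≤δn ⟩
    δ ℚ.* ℕ→ℚ n ℚ.+ α ℚ.* ℕ→ℚ n        ≡⟨ ℚ.*-distribʳ-+ (ℕ→ℚ n) δ α ⟨
    (δ ℚ.+ α) ℚ.* ℕ→ℚ n                ≤⟨ G-deg v ⟩
    ℕ→ℚ (degree G v)                   ∎
    where open ℚ.≤-Reasoning

  m≤degree : ∀ v → m ≤ degree G v
  m≤degree v = ℕ→ℚ-cancel-≤ (ℚ.≤-trans (ℚ.≤-trans (ℚ.≤-reflexive (sym (ℚ.+-identityʳ (ℕ→ℚ m))))
    (ℚ.+-monoʳ-≤ (ℕ→ℚ m) (ℚ.nonNegative⁻¹ _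
      {{ℚ.nonNeg*nonNeg⇒nonNeg α {{ℚ.pos⇒nonNeg α}} (ℕ→ℚ n) {{ℕ→ℚ-nonNeg n}}}}))) (degree-surplus v))

  -- Taking for `d` the exact minimum degree minus `m` gives a natural number that is at least αn,
  -- so αn is never rounded.
  surplus : Fin n → Σ[ d ∈ ℕ ] (∀ v → m + d ≤ degree G v) × d ≤ n × α ℚ.* ℕ→ℚ n ℚ.≤ ℕ→ℚ d
  surplus v₀ = d , (λ v → ≤-trans (≤-reflexive m+d≡) (minimal v)) ,
    ≤-trans (m∸n≤m _ m) (card≤n (adj G v⁻)) , αn≤d
    where
    v⁻ : Fin n
    v⁻ = argmin (degree G) v₀ (allFin n)
    minimal : ∀ v → degree G v⁻ ≤ degree G v
    minimal v = All.lookup (f[argmin]≤f[xs] {f = degree G} v₀ (allFin n)) (∈-allFin v)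
    d : ℕ
    d = degree G v⁻ ∸ m
    m+d≡ : m + d ≡ degree G v⁻
    m+d≡ = m+[n∸m]≡n (m≤degree v⁻)
    αn≤d : α ℚ.* ℕ→ℚ n ℚ.≤ ℕ→ℚ d
    αn≤d = begin
      α ℚ.* ℕ→ℚ n                                       ≡⟨ cancel (ℕ→ℚ m) (α ℚ.* ℕ→ℚ n) ⟩
      ℚ.- ℕ→ℚ m ℚ.+ (ℕ→ℚ m ℚ.+ α ℚ.* ℕ→ℚ n)             ≤⟨ ℚ.+-monoʳ-≤ (ℚ.- ℕ→ℚ m) (degree-surplus v⁻) ⟩
      ℚ.- ℕ→ℚ m ℚ.+ ℕ→ℚ (degree G v⁻)                   ≡⟨ cong (λ k → ℚ.- ℕ→ℚ m ℚ.+ k) (trans (cong ℕ→ℚ (sym m+d≡)) (ℕ→ℚ-+ m d)) ⟩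
      ℚ.- ℕ→ℚ m ℚ.+ (ℕ→ℚ m ℚ.+ ℕ→ℚ d)                   ≡⟨ cancel (ℕ→ℚ m) (ℕ→ℚ d) ⟨
      ℕ→ℚ d                                             ∎
      where
      open ℚ.≤-Reasoning
      cancel : ∀ x y → y ≡ ℚ.- x ℚ.+ (x ℚ.+ y)
      cancel x y = sym (trans (sym (ℚ.+-assoc (ℚ.- x) x y))
                     (trans (cong (ℚ._+ y) (ℚ.+-inverseˡ x)) (ℚ.+-identityˡ y)))

  m≤n : m ≤ n
  m≤n with n ≟ 0
  ... | yes refl = ℕ→ℚ-cancel-≤ (ℚ.≤-trans m≤δn (ℚ.≤-reflexive (ℚ.*-zeroʳ δ)))
  ... | no n≢0 = let v = fromℕ< (n≢0⇒n>0 n≢0) in ≤-trans (m≤degree v) (card≤n (adj G v))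

-- Degenerate cases and assembly

edgeless-embeds : ∀ {m n} (H : Graph m) (G : Graph n) → m ≤ n → BandwidthAtMost H 0 → SubgraphOf H G
edgeless-embeds H G m≤n (σ , band) =
  (λ x → inject≤ x m≤n) , (λ {x} {y} → inject≤-injective m≤n m≤n x y) , λ u v uv →
    contradiction (trans (sym uv) (trans (cong (λ w → adj H w v) (same-label u v uv)) (irrefl H v))) λ ()
  where
  same-label : ∀ u v → adj H u v ≡ true → u ≡ v
  same-label u v uv = trans (sym (inverseˡ σ)) (trans
    (cong (σ ⟨$⟩ˡ_) (toℕ-injective (∣m-n∣≡0⇒m≡n (n≤0⇒n≡0 (band u v uv))))) (inverseˡ σ))

trivial-embeds : ∀ {m} (H : Graph m) (G : Graph 0) → m ≤ 0 → SubgraphOf H G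
trivial-embeds H G z≤n = (λ ()) , (λ { {()} }) , λ ()

surplus-embeds : ∀ {n m} (G : Graph n) (H : Graph m) α → .{{Positive α}} → ∀ Δ b →
  {{_ : NonZero n}} {{_ : NonZero Δ}} {{_ : NonZero b}} → MaxDegreeAtMost H Δ → Bipartite H →
  ℕ→ℚ b ℚ.≤ (ℤ.+ 1 ℚ./ 256) ℚ.* (ℤ.+ 1 ℚ./ Δ) ℚ.* (α ^ℚ (6 * Δ + 1)) ℚ.* ℕ→ℚ n → BandwidthAtMost H b →
  Σ[ d ∈ ℕ ] (∀ v → m + d ≤ degree G v) × d ≤ n × α ℚ.* ℕ→ℚ n ℚ.≤ ℕ→ℚ d →
  SubgraphOf H G
surplus-embeds {n} G H α Δ b H-deg (colour , proper) b≤ (σ , band) (d , m+d≤ , d≤n , αn≤d) =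
  Stages.embeds G H d Δ b
    (Constants.parameters n d Δ b d≤n (clear-denominators α 256 Δ n d b (6 * Δ) αn≤d b≤))
    m+d≤ H-deg colour proper σ band

theorem1p6 : (δ α : ℚ) → Positive δ → Positive α →
    (Δ : ℕ) → .{{_ : NonZero Δ}} →
    (n : ℕ) (G : Graph n) → MinDegreeAtLeast G ((δ ℚ.+ α) ℚ.* ℕ→ℚ n) →
    (m : ℕ) (H : Graph m) → Bipartite H →
    ℕ→ℚ m ℚ.≤ δ ℚ.* ℕ→ℚ n →
    MaxDegreeAtMost H Δ →
    (b : ℕ) → ℕ→ℚ b ℚ.≤ (ℤ.+ 1 ℚ./ 256) ℚ.* (ℤ.+ 1 ℚ./ Δ) ℚ.* (α ^ℚ (6 ℕ.* Δ ℕ.+ 1)) ℚ.* ℕ→ℚ n →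
    BandwidthAtMost H b →
    SubgraphOf H G
-- The case b = 0 stands apart because windows of length 2b would not advance. There `H` has no
-- edges: the ends of an edge would share a label.
theorem1p6 δ α _ α>0 Δ n G G-deg m H _ m≤δn H-deg zero _ bw =
  edgeless-embeds H G (m≤n G δ α {{α>0}} m G-deg m≤δn) bw
-- An empty `G` has no vertex of minimum degree, but then `H` is empty as well.
theorem1p6 δ α _ α>0 Δ zero G G-deg m H _ m≤δn H-deg (suc b) _ _ =
  trivial-embeds H G (m≤n G δ α {{α>0}} m G-deg m≤δn)
theorem1p6 δ α _ α>0 (suc Δ) (suc n) G G-deg m H bip m≤δn H-deg (suc b) b≤ bw =
  surplus-embeds G H α {{α>0}} (suc Δ) (suc b) H-deg bip b≤ bw
    (surplus G δ α {{α>0}} m G-deg m≤δn Fin.zero)
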